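{- Let $q$ be a prime power, let $n$ be a non-negative integer, and let $M_q$ be a coordinate $q$-matroid on $\mathbb{F}_q^n$. If the corresponding matroid of $M_q$ (a matroid on $[n]$) is a transversal matroid, then $M_q$ is a transversal $q$-matroid and $M_q$ is representable.
   Context: A $q$-matroid $M=(E,\rho)$ consists of a finite-dimensional vector space $E$ over a finite field $\mathbb{F}_q$ and a function $\rho$ from the set of subspaces of $E$ to $\mathbb{Z}_{\ge 0}$ such that for all $X,Y\le E$: $0\le\rho(X)\le\dim X$; $X\le Y$ implies $\rho(X)\le\rho(Y)$; and $\rho(X+Y)+\rho(X\cap Y)\le\rho(X)+\rho(Y)$. A subspace $X$ is independent if $\rho(X)=\dim X$; it is a flat if $\rho(X)<\rho(X\oplus\langle v\rangle)$ for all $v\in E\setminus X$; it is cyclic if $\rho(H)=\rho(X)$ for every hyperplane $H$ of $X$ (subspace of $X$ of dimension $\dim X-1$); it is a cyclic flat if it is both. A $q$-matroid is determined by its independent spaces, and also by its weighted cyclic flats $(\mathcal{Z},\lambda)$, where $\mathcal{Z}$ is the set of its cyclic flats and $\lambda=\rho|_{\mathcal{Z}}$. Analogously for a matroid $(S,r)$: $X\subseteq S$ is a flat if $r(X)<r(X\cup\{s\})$ for all $s\in S\setminus X$, cyclic if $r(X\setminus\{x\})=r(X)$ for all $x\in X$, a cyclic flat if both; a matroid is determined by its weighted cyclic flats. A subspace of $\mathbb{F}_q^n$ is coordinate if it is spanned by a subset of the standard basis vectors $e_1,\dots,e_n$. A coordinate $q$-matroid is a $q$-matroid on $\mathbb{F}_q^n$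 all of whose cyclic flats are coordinate subspaces. For $S\subseteq[n]$ let $\phi(S)=\langle e_i:i\in S\rangle$; for a coordinate subspace $X$, $\phi^{ -1}(X)$ is the unique $S\subseteq[n]$ with $\phi(S)=X$. If $M_q$ is a coordinate $q$-matroid with weighted cyclic flats $(\mathcal{Z},\lambda)$, its corresponding matroid is the (existing and unique) matroid on $[n]$ whose weighted cyclic flats are $(\{\phi^{ -1}(Z):Z\in\mathcal{Z}\},\lambda\circ\phi)$. Given a finite family (repetitions allowed) $\mathcal{A}$ of $k$ subsets of a set, a finite set $X$ has an avoidance transversal of $\mathcal{A}$ if there are orderings $X=\{x_1,\dots,x_\ell\}$ and $\mathcal{A}=(A_1,\dots,A_k)$, with $\ell\le k$, such that $x_i\notin A_i$ for each $i\in[\ell]$. A matroid on a finite set $S$ is an (avoidance) transversal matroid if there is a finite family $\mathcal{A}$ of subsets of $S$ (a presentation) such that its independent sets are exactly the subsets of $S$ that have an avoidance transversal of $\mathcal{A}$; by taking complements this is the same as the usual notion of transversal matroid. A $q$-matroid on $E$ is a transversal $q$-matroid if there is a finite family $\mathcal{X}=(X_1,\dots,X_k)$ of subspaces of $E$ (a presentation) such that its independent spaces are exactly the partial $q$-transversals of $\mathcal{X}$, i.e. the subspaces $X\le E$ such that every linear basis of $X$ has an avoidance transversal of $\mathcal{X}$. A $q$-matroid $(\mathbb{F}_q^n,\rho)$ is representable if there are $m\ge 1$ and a matrix $G$ with $n$ columns over $\mathbb{F}_{q^m}$ such that $\rho(X)=\operatorname{rank}_{\mathbb{F}_{q^m}}(GA_X^{T})$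 for every $X\le\mathbb{F}_q^n$, where $A_X$ is any matrix over $\mathbb{F}_q$ whose row space is $X$. -}

module Defs where

open import Level using (Level; _⊔_) renaming (suc to lsuc)
open import Data.Nat.Base as ℕ using (ℕ; zero; suc; _≤_; _<_; _^_)
import Data.Nat.Properties as ℕ
open import Data.Nat.Primality using (Prime)
open import Data.Fin.Base using (Fin; zero; suc; inject≤; finToFun; funToFin)
  renaming (combine to combineFin)
open import Data.Fin.Properties as Fin
  using (any?; finToFun-funToFin; funToFin-finToFin; injective⇒≤)
open import Data.Fin.Permutation using (Permutation′; _⟨$⟩ʳ_)
open import Data.Fin.Subset as Subset using (Subset; ∣_∣; ⁅_⁆; _∪_; _-_)
open import Data.Fin.Subset.Properties using () renaming (_∈?_ to _∈ˢ?_)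
open import Data.List.Base as List using (allFin; filter)
open import Data.Product.Base using (Σ-syntax; ∃; ∃₂; _×_; _,_; proj₁; proj₂)
open import Data.Vec.Functional using (Vector; _∷_; []; fromList)
open import Algebra.Bundles using (CommutativeRing)
open import Algebra.Morphism.Structures using (module RingMorphisms)
open import Function.Base using (_∘_)
open import Function.Bundles using (Inverse; Injection; _⇔_)
open import Function.Definitions using (Injective)
open import Function.Properties.Inverse using (Inverse⇒Injection)
open import Relation.Binary.Bundles using (Setoid)
open import Relation.Binary.PropositionalEquality as ≡ using (_≡_)
open import Relation.Nullary using (¬_; Dec; yes; no; contradiction)
open import Relation.Nullary.Decidable using (map′; via-injection; _×-dec_)
open import Relation.Unary using (Pred)

private
  variable
    a c p p′ ℓ : Level
    k l n q : ℕ

IsPrimePower : ℕ → Set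
IsPrimePower q = ∃₂ λ π e → Prime π × 1 ≤ e × q ≡ π ^ e

record FiniteField c ℓ (q : ℕ) : Set (lsuc (c ⊔ ℓ)) where
  field
    commutativeRing : CommutativeRing c ℓ
  open CommutativeRing commutativeRing public
  field
    0≉1         : 0# ≉ 1#
    inverse     : ∀ x → x ≉ 0# → ∃ λ y → x * y ≈ 1#
    enumeration : Inverse setoid (≡.setoid (Fin q))

  infix 4 _≟_
  _≟_ : ∀ x y → Dec (x ≈ y)
  _≟_ = via-injection (Inverse⇒Injection enumeration) Fin._≟_

-- Ring homomorphisms between fields are injective, so this makes K an
-- extension of F; its degree is read off from the cardinalities.
record Extension {q q′} (F : FiniteField c ℓ q) (K : FiniteField c ℓ q′)
  : Set (c ⊔ ℓ) where
  private
    module F = FiniteField F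
    module K = FiniteField K
  open RingMorphisms F.rawRing K.rawRing using (IsRingHomomorphism)
  field
    ι                  : F.Carrier → K.Carrier
    isRingHomomorphism : IsRingHomomorphism ι

module LinearAlgebra {c ℓ q} (F : FiniteField c ℓ q) where
  open FiniteField F hiding (zero)
  open import Algebra.Properties.CommutativeMonoid.Sum +-commutativeMonoid
    using (sum; sum-cong-≋; ∑-distrib-+)
  open import Algebra.Properties.Semiring.Sum semiring using (*-distribˡ-sum)
  open import Algebra.Properties.Ring ring
    using (-‿distribˡ-*; -‿involutive; -1*x≈-x; x∙y⁻¹≈ε⇒x≈y; x≈y⇒x∙y⁻¹≈ε)
  open import Data.Vec.Functional.Relation.Binary.Equality.Setoid setoid public
    using (_≋_; ≋-refl; ≋-sym; ≋-trans; ≋-setoid)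
  open import Relation.Binary.Reasoning.Setoid setoid

  V : ℕ → Set c
  V n = Vector Carrier n

  infixl 6 _+ᵥ_
  infixr 7 _*ᵥ_

  0ᵥ : V n
  0ᵥ _ = 0#

  _+ᵥ_ : V n → V n → V n
  (v +ᵥ w) i = v i + w i

  _*ᵥ_ : Carrier → V n → V n
  (s *ᵥ v) i = s * v i

  e : Fin n → V n
  e i j with i Fin.≟ j
  ... | yes _ = 1#
  ... | no  _ = 0#

  combine : V k → Vector (V n) k → V n
  combine s b j = sum λ i → s i * b i j

  -- Membership is required to be decidable; over a finite field this holds
  -- classically for every subspace, and it means that the subspace is
  -- spanned by an explicit finite list of vectors.
  record Subspace (n : ℕ) : Set (lsuc (c ⊔ ℓ)) where
    field
      Member  : Pred (V n) (c ⊔ ℓ)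
      member? : ∀ v → Dec (Member v)
      resp    : ∀ {v w} → v ≋ w → Member v → Member w
      zeroᵐ   : Member 0ᵥ
      addᵐ    : ∀ {v w} → Member v → Member w → Member (v +ᵥ w)
      scaleᵐ  : ∀ s {v} → Member v → Member (s *ᵥ v)

  open Subspace

  infix 4 _∈_ _∉_ _∈?_ _⊆_ _≐_

  _∈_ _∉_ : V n → Subspace n → Set (c ⊔ ℓ)
  v ∈ X = Member X v
  v ∉ X = ¬ v ∈ X

  _∈?_ : (v : V n) (X : Subspace n) → Dec (v ∈ X)
  v ∈? X = member? X v

  _⊆_ _≐_ : Subspace n → Subspace n → Set (c ⊔ ℓ)
  X ⊆ Y = ∀ {v} → v ∈ X → v ∈ Y
  X ≐ Y = X ⊆ Y × Y ⊆ X

  vector : Fin (q ^ n) → V n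
  vector i = Inverse.from enumeration ∘ finToFun i

  index : V n → Fin (q ^ n)
  index v = funToFin (Inverse.to enumeration ∘ v)

  vector-index : (v : V n) → vector (index v) ≋ v
  vector-index v i = Inverse.inverseʳ enumeration
    (finToFun-funToFin (Inverse.to enumeration ∘ v) i)

  index-injective : {v w : V n} → index v ≡ index w → v ≋ w
  index-injective {v = v} {w} eq =
    ≋-trans (≋-sym (vector-index v))
      (≡.subst (λ i → vector i ≋ w) (≡.sym eq) (vector-index w))

  search : {P : Pred (V n) p} → (∀ {v w} → v ≋ w → P v → P w) →
           (∀ v → Dec (P v)) → Dec (∃ P)
  search P-resp P? = map′
    (λ (i , Pi) → vector i , Pi)
    (λ (v , Pv) → index v , P-resp (≋-sym (vector-index v)) Pv)
    (any? (P? ∘ vector))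

  infix 4 _≋?_
  _≋?_ : (v w : V n) → Dec (v ≋ w)
  v ≋? w = Fin.all? λ i → v i ≟ w i

  infixr 7 _∩_
  infixr 6 _⊕_

  _∩_ : Subspace n → Subspace n → Subspace n
  X ∩ Y = record
    { Member  = λ v → v ∈ X × v ∈ Y
    ; member? = λ v → v ∈? X ×-dec v ∈? Y
    ; resp    = λ eq (x , y) → resp X eq x , resp Y eq y
    ; zeroᵐ   = zeroᵐ X , zeroᵐ Y
    ; addᵐ    = λ (x , y) (x′ , y′) → addᵐ X x x′ , addᵐ Y y y′
    ; scaleᵐ  = λ s (x , y) → scaleᵐ X s x , scaleᵐ Y s y
    }

  private
    interchange : ∀ x y z w → (x + y) + (z + w) ≈ (x + z) + (y + w)
    interchange x y z w = begin
      (x + y) + (z + w) ≈⟨ +-assoc x y (z + w) ⟩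
      x + (y + (z + w)) ≈⟨ +-congˡ (+-assoc y z w) ⟨
      x + ((y + z) + w) ≈⟨ +-congˡ (+-congʳ (+-comm y z)) ⟩
      x + ((z + y) + w) ≈⟨ +-congˡ (+-assoc z y w) ⟩
      x + (z + (y + w)) ≈⟨ +-assoc x z (y + w) ⟨
      (x + z) + (y + w) ∎

  -- The sum X + Y, not necessarily direct.
  _⊕_ : Subspace n → Subspace n → Subspace n
  X ⊕ Y = record
    { Member  = λ v → ∃₂ λ x y → x ∈ X × y ∈ Y × v ≋ x +ᵥ y
    ; member? = λ v → search
        (λ eq (y , x∈ , y∈ , v≋) →
          y , resp X eq x∈ , y∈ , λ i → trans (v≋ i) (+-congʳ (eq i)))
        λ x → search
          (λ eq (x∈ , y∈ , v≋) →
            x∈ , resp Y eq y∈ , λ i → trans (v≋ i) (+-congˡ (eq i)))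
          λ y → x ∈? X ×-dec (y ∈? Y ×-dec v ≋? x +ᵥ y)
    ; resp    = λ eq (x , y , x∈ , y∈ , v≋) →
        x , y , x∈ , y∈ , ≋-trans (≋-sym eq) v≋
    ; zeroᵐ   = 0ᵥ , 0ᵥ , zeroᵐ X , zeroᵐ Y , λ _ → sym (+-identityˡ 0#)
    ; addᵐ    = λ (x , y , x∈ , y∈ , v≋) (x′ , y′ , x′∈ , y′∈ , w≋) →
        x +ᵥ x′ , y +ᵥ y′ , addᵐ X x∈ x′∈ , addᵐ Y y∈ y′∈ ,
        λ i → trans (+-cong (v≋ i) (w≋ i)) (interchange _ _ _ _)
    ; scaleᵐ  = λ s (x , y , x∈ , y∈ , v≋) →
        s *ᵥ x , s *ᵥ y , scaleᵐ X s x∈ , scaleᵐ Y s y∈ ,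
        λ i → trans (*-congˡ (v≋ i)) (distribˡ s _ _)
    }

  combine-cong : {s t : V k} (b : Vector (V n) k) → s ≋ t →
                 combine s b ≋ combine t b
  combine-cong b s≋t j = sum-cong-≋ λ i → *-congʳ (s≋t i)

  combine-+ : (s t : V k) (b : Vector (V n) k) →
              combine (s +ᵥ t) b ≋ combine s b +ᵥ combine t b
  combine-+ s t b j = trans (sum-cong-≋ λ i → distribʳ (b i j) (s i) (t i))
    (∑-distrib-+ (λ i → s i * b i j) (λ i → t i * b i j))

  combine-* : ∀ x (s : V k) (b : Vector (V n) k) →
              combine (x *ᵥ s) b ≋ x *ᵥ combine s b
  combine-* x s b j = trans (sum-cong-≋ λ i → *-assoc x (s i) (b i j))
    (sym (*-distribˡ-sum x λ i → s i * b i j))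

  combine-0 : (b : Vector (V n) k) → combine 0ᵥ b ≋ 0ᵥ
  combine-0 {k = zero}  b j = refl
  combine-0 {k = suc k} b j =
    trans (+-cong (zeroˡ _) (combine-0 (b ∘ suc) j)) (+-identityˡ 0#)

  span : Vector (V n) k → Subspace n
  span b = record
    { Member  = λ v → ∃ λ s → v ≋ combine s b
    ; member? = λ v → search
        (λ s≋t v≋ → ≋-trans v≋ (combine-cong b s≋t))
        λ s → v ≋? combine s b
    ; resp    = λ eq (s , v≋) → s , ≋-trans (≋-sym eq) v≋
    ; zeroᵐ   = 0ᵥ , ≋-sym (combine-0 b)
    ; addᵐ    = λ (s , v≋) (t , w≋) → s +ᵥ t ,
        λ i → trans (+-cong (v≋ i) (w≋ i)) (sym (combine-+ s t b i))
    ; scaleᵐ  = λ x (s , v≋) → x *ᵥ s ,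
        λ i → trans (*-congˡ (v≋ i)) (sym (combine-* x s b i))
    }

  ⟨_⟩ : V n → Subspace n
  ⟨ v ⟩ = span (v ∷ [])

  φ : Subset n → Subspace n
  φ {n} S = span (fromList (List.map e (filter (_∈ˢ? S) (allFin n))))

  LinearlyIndependent : Vector (V n) k → Set (c ⊔ ℓ)
  LinearlyIndependent b = ∀ s → combine s b ≋ 0ᵥ → s ≋ 0ᵥ

  record IsBasis (X : Subspace n) {k} (b : Vector (V n) k) : Set (c ⊔ ℓ) where
    field
      contained   : ∀ i → b i ∈ X
      independent : LinearlyIndependent b
      spanning    : X ⊆ span b

  shift : (v : V n) (b : Vector (V n) k) → span b ⊆ span (v ∷ b)
  shift v b (s , eq) = 0# ∷ s , λ j →
    trans (eq j) (sym (trans (+-congʳ (zeroˡ _)) (+-identityˡ _)))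

  head∈ : (v : V n) (b : Vector (V n) k) → v ∈ span (v ∷ b)
  head∈ v b = 1# ∷ 0ᵥ , λ j → sym (trans
    (+-cong (*-identityˡ _) (combine-0 b j)) (+-identityʳ _))

  solve : ∀ {x y u z} → x * y ≈ 1# → x * u + z ≈ 0# → u ≈ (- y) * z
  solve {x} {y} {u} {z} xy≈1 eq = x∙y⁻¹≈ε⇒x≈y _ _ (begin
    u + - (- y * z)       ≈⟨ +-congˡ (-‿cong (sym (-‿distribˡ-* y z))) ⟩
    u + - (- (y * z))     ≈⟨ +-congˡ (-‿involutive (y * z)) ⟩
    u + y * z             ≈⟨ +-congʳ (*-identityˡ u) ⟨
    1# * u + y * z        ≈⟨ +-congʳ (*-congʳ (trans (*-comm y x) xy≈1)) ⟨
    (y * x) * u + y * z   ≈⟨ +-congʳ (*-assoc y x u) ⟩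
    y * (x * u) + y * z   ≈⟨ distribˡ y _ _ ⟨
    y * (x * u + z)       ≈⟨ *-congˡ eq ⟩
    y * 0#                ≈⟨ zeroʳ y ⟩
    0#                    ∎)

  extend : {v : V n} {b : Vector (V n) k} → LinearlyIndependent b →
           v ∉ span b → LinearlyIndependent (v ∷ b)
  extend {v = v} {b} indep v∉ s eq with s zero ≟ 0#
  ... | no s₀≉0 = contradiction
    (- y *ᵥ (s ∘ suc) , λ j →
      trans (solve xy≈1 (eq j)) (sym (combine-* (- y) (s ∘ suc) b j)))
    v∉
    where
    y    = proj₁ (inverse (s zero) s₀≉0)
    xy≈1 = proj₂ (inverse (s zero) s₀≉0)
  ... | yes s₀≈0 = λ where
    zero    → s₀≈0
    (suc i) → indep (s ∘ suc) (λ j → begin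
      combine (s ∘ suc) b j                  ≈⟨ +-identityˡ _ ⟨
      0# + combine (s ∘ suc) b j             ≈⟨ +-congʳ (trans (*-congʳ s₀≈0) (zeroˡ _)) ⟨
      s zero * v j + combine (s ∘ suc) b j   ≈⟨ eq j ⟩
      0#                                     ∎) i

  greedy : (X : Subspace n) (w : Vector (V n) l) →
           ∃ λ k → Σ[ b ∈ Vector (V n) k ] (∀ i → b i ∈ X) ×
             LinearlyIndependent b × (∀ i → w i ∈ X → w i ∈ span b)
  greedy {l = zero}  X w = 0 , [] , (λ ()) , (λ _ _ ()) , λ ()
  greedy {l = suc l} X w with greedy X (w ∘ suc)
  ... | k , b , b∈ , indep , covers with w zero ∈? X | w zero ∈? span b
  ...   | no w∉X | _ = k , b , b∈ , indep , λ where
    zero    w∈X → contradiction w∈X w∉X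
    (suc i) → covers i
  ...   | yes _ | yes w∈b = k , b , b∈ , indep , λ where
    zero    _ → w∈b
    (suc i) → covers i
  ...   | yes w∈X | no w∉b =
    suc k , w zero ∷ b , (λ where zero → w∈X ; (suc i) → b∈ i) ,
    extend indep w∉b , λ where
      zero    _   → head∈ (w zero) b
      (suc i) wᵢ∈ → shift (w zero) b (covers i wᵢ∈)

  basis : (X : Subspace n) → ∃ λ k → Σ[ b ∈ Vector (V n) k ] IsBasis X b
  basis {n} X with greedy X (vector {n})
  ... | k , b , b∈ , indep , covers = k , b , record
    { contained   = b∈
    ; independent = indep
    ; spanning    = λ {v} v∈ → resp (span b) (vector-index v)
        (covers (index v) (resp X (≋-sym (vector-index v)) v∈))
    }

  -- Independent of the chosen basis, by dim-unique below.
  dim : Subspace n → ℕ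
  dim X = proj₁ (basis X)

  combine∈ : (X : Subspace n) (b : Vector (V n) k) → (∀ i → b i ∈ X) →
             ∀ s → combine s b ∈ X
  combine∈ {k = zero}  X b b∈ s = zeroᵐ X
  combine∈ {k = suc k} X b b∈ s =
    addᵐ X (scaleᵐ X (s zero) (b∈ zero)) (combine∈ X (b ∘ suc) (b∈ ∘ suc) (s ∘ suc))

  combine-injective : (b : Vector (V n) k) → LinearlyIndependent b →
                      ∀ {s t} → combine s b ≋ combine t b → s ≋ t
  combine-injective b indep {s} {t} eq i = x∙y⁻¹≈ε⇒x≈y _ _ (begin
    s i + - t i         ≈⟨ +-congˡ (-1*x≈-x (t i)) ⟨
    s i + - 1# * t i    ≈⟨ indep (s +ᵥ - 1# *ᵥ t) (λ j → begin
      combine (s +ᵥ - 1# *ᵥ t) b j             ≈⟨ combine-+ s (- 1# *ᵥ t) b j ⟩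
      combine s b j + combine (- 1# *ᵥ t) b j  ≈⟨ +-congˡ (combine-* (- 1#) t b j) ⟩
      combine s b j + - 1# * combine t b j     ≈⟨ +-congˡ (-1*x≈-x _) ⟩
      combine s b j + - combine t b j          ≈⟨ x≈y⇒x∙y⁻¹≈ε (eq j) ⟩
      0#                                       ∎) i ⟩
    0#                  ∎)

  vector-injective : {i j : Fin (q ^ n)} → vector {n} i ≋ vector j → i ≡ j
  vector-injective {n} {i} {j} eq = ≡.trans (≡.sym (index-vector i))
    (≡.trans (funToFin-cong λ t → Inverse.to-cong enumeration (eq t))
      (index-vector j))
    where
    funToFin-cong : ∀ {m} {f g : Fin m → Fin q} → (∀ t → f t ≡ g t) →
                    funToFin f ≡ funToFin g
    funToFin-cong {zero}  eq = ≡.refl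
    funToFin-cong {suc m} eq =
      ≡.cong₂ combineFin (eq zero) (funToFin-cong (eq ∘ suc))

    index-vector : ∀ i → index (vector {n} i) ≡ i
    index-vector i = ≡.trans
      (funToFin-cong {n} λ t → Inverse.inverseˡ enumeration refl)
      (funToFin-finToFin {n} i)

  1<q : 1 < q
  1<q = injective⇒≤ f-injective
    where
    to-injective = Injection.injective (Inverse⇒Injection enumeration)
    f : Fin 2 → Fin q
    f zero    = Inverse.to enumeration 0#
    f (suc _) = Inverse.to enumeration 1#
    f-injective : Injective _≡_ _≡_ f
    f-injective {zero}     {zero}     _  = ≡.refl
    f-injective {suc zero} {suc zero} _  = ≡.refl
    f-injective {zero}     {suc zero} eq = contradiction (to-injective eq) 0≉1
    f-injective {suc zero} {zero}     eq =
      contradiction (sym (to-injective eq)) 0≉1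

  basis-≤ : (X : Subspace n) {b : Vector (V n) k} {b′ : Vector (V n) l} →
            IsBasis X b → IsBasis X b′ → k ≤ l
  basis-≤ {n} {k} {l} X {b} {b′} B B′ =
    ℕ.≮⇒≥ λ l<k → ℕ.<⇒≱ (ℕ.^-monoʳ-< q 1<q l<k) (injective⇒≤ f-injective)
    where
    module B  = IsBasis B
    module B′ = IsBasis B′
    coords : ∀ s → combine s b ∈ span b′
    coords s = B′.spanning (combine∈ X b B.contained s)
    f : Fin (q ^ k) → Fin (q ^ l)
    f i = index (proj₁ (coords (vector i)))
    f-injective : Injective _≡_ _≡_ f
    f-injective {i} {j} eq = vector-injective (combine-injective b B.independent
      (≋-trans (proj₂ (coords (vector i)))
        (≋-trans (combine-cong b′ (index-injective eq))
          (≋-sym (proj₂ (coords (vector j)))))))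

  dim-unique : (X : Subspace n) {b : Vector (V n) k} → IsBasis X b → dim X ≡ k
  dim-unique X B = ℕ.≤-antisym (basis-≤ X B₀ B) (basis-≤ X B B₀)
    where B₀ = proj₂ (proj₂ (basis X))

  image : Vector (V n) k → Pred (V n) ℓ
  image b v = ∃ λ i → v ≋ b i

  Matrix : ℕ → ℕ → Set c
  Matrix k n = Vector (V n) k

  rowSpace : Matrix k n → Subspace n
  rowSpace = span

  rank : Matrix k n → ℕ
  rank A = dim (rowSpace A)

  infixl 7 _·_
  _·_ : Matrix k l → Matrix l n → Matrix k n
  (A · B) i j = sum λ t → A i t * B t j

module _ (U : Setoid a ℓ) where
  open Setoid U using (_≈_) renaming (Carrier to |U|)

  record IsOrdering (X : Pred |U| p) (x : Vector |U| l) : Set (a ⊔ ℓ ⊔ p) where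
    field
      distinct : Injective _≡_ _≈_ x
      listed   : ∀ i → X (x i)
      complete : ∀ {u} → X u → ∃ λ i → u ≈ x i

  -- The orderings of the family A are the families A ∘ τ.
  record HasAvoidanceTransversal (A : Vector (Pred |U| p′) k) (X : Pred |U| p)
    : Set (a ⊔ ℓ ⊔ p ⊔ p′) where
    field
      {size}   : ℕ
      x        : Vector |U| size
      ordering : IsOrdering X x
      size≤k   : size ≤ k
      τ        : Permutation′ k
      avoids   : ∀ i → ¬ A (τ ⟨$⟩ʳ inject≤ i size≤k) (x i)

record Matroid (n : ℕ) : Set where
  field
    r          : Subset n → ℕ
    bounded    : ∀ X → r X ≤ ∣ X ∣
    monotone   : ∀ {X Y} → X Subset.⊆ Y → r X ≤ r Y
    submodular : ∀ X Y → r (X ∪ Y) ℕ.+ r (X Subset.∩ Y) ≤ r X ℕ.+ r Y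

  Independent Flat Cyclic CyclicFlat : Subset n → Set
  Independent X = r X ≡ ∣ X ∣
  Flat X        = ∀ {s} → s Subset.∉ X → r X < r (X ∪ ⁅ s ⁆)
  Cyclic X      = ∀ {x} → x Subset.∈ X → r (X - x) ≡ r X
  CyclicFlat X  = Flat X × Cyclic X

IsTransversal : Matroid n → Set
IsTransversal {n} M = ∃ λ k → Σ[ A ∈ Vector (Subset n) k ] ∀ X →
  Matroid.Independent M X ⇔
  HasAvoidanceTransversal (≡.setoid (Fin n)) (λ i → Subset._∈ A i) (Subset._∈ X)

module _ (F : FiniteField c ℓ q) where
  open LinearAlgebra F

  -- Monotonicity forces ρ to agree on subspaces with the same vectors.
  record QMatroid (n : ℕ) : Set (lsuc (c ⊔ ℓ)) where
    field
      ρ          : Subspace n → ℕ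
      bounded    : ∀ X → ρ X ≤ dim X
      monotone   : ∀ X Y → X ⊆ Y → ρ X ≤ ρ Y
      submodular : ∀ X Y → ρ (X ⊕ Y) ℕ.+ ρ (X ∩ Y) ≤ ρ X ℕ.+ ρ Y

    Independent : Subspace n → Set
    Independent X = ρ X ≡ dim X

    Flat : Subspace n → Set (c ⊔ ℓ)
    Flat X = ∀ {v} → v ∉ X → ρ X < ρ (X ⊕ ⟨ v ⟩)

    Cyclic CyclicFlat : Subspace n → Set (lsuc (c ⊔ ℓ))
    Cyclic X     = ∀ H → H ⊆ X → suc (dim H) ≡ dim X → ρ H ≡ ρ X
    CyclicFlat X = Flat X × Cyclic X

module _ {F : FiniteField c ℓ q} where
  open LinearAlgebra F

  IsCoordinate : QMatroid F n → Set (lsuc (c ⊔ ℓ))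
  IsCoordinate M = ∀ Z → QMatroid.CyclicFlat M Z → ∃ λ S → Z ≐ φ S

  record IsCorrespondingMatroid (Mq : QMatroid F n) (M : Matroid n)
    : Set (lsuc (c ⊔ ℓ)) where
    private
      module Mq = QMatroid Mq
      module M  = Matroid M
    field
      cyclicFlats : ∀ S → M.CyclicFlat S ⇔ (∃ λ Z → Mq.CyclicFlat Z × Z ≐ φ S)
      ranks       : ∀ S → M.CyclicFlat S → M.r S ≡ Mq.ρ (φ S)

  IsPartialQTransversal : Vector (Subspace n) k → Subspace n → Set (c ⊔ ℓ)
  IsPartialQTransversal {n} 𝒳 X = ∀ {d} (b : Vector (V n) d) → IsBasis X b →
    HasAvoidanceTransversal (≋-setoid n) (λ i → _∈ 𝒳 i) (image b)

  IsQTransversal : QMatroid F n → Set (lsuc (c ⊔ ℓ))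
  IsQTransversal {n} M = ∃ λ k → Σ[ 𝒳 ∈ Vector (Subspace n) k ] ∀ X →
    QMatroid.Independent M X ⇔ IsPartialQTransversal 𝒳 X

  IsRepresentable : QMatroid F n → Set (lsuc (c ⊔ ℓ))
  IsRepresentable {n} M =
    ∃ λ m → 1 ≤ m ×
    Σ[ K ∈ FiniteField c ℓ (q ^ m) ] Σ[ E ∈ Extension F K ]
    let module K = LinearAlgebra K
        ι = Extension.ι E
    in ∃ λ h → Σ[ G ∈ K.Matrix h n ]
       ∀ X {k} (A : Matrix k n) → X ≐ rowSpace A →
       QMatroid.ρ M X ≡ K.rank (G K.· (λ i j → ι (A j i)))

{-# OPTIONS --safe #-}

-- Write N(S) for the set of indices i with S ⊈ Aᵢ. A subset S has rank at most
-- |N(S)|, with equality if S is cyclic, by Kőnig's theorem. A rank function is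
-- the minimum of λ(Z) + dim X - dim (X ∩ Z) over the cyclic flats Z, and the
-- cyclic flats of M_q are the φ(S) for those of M; so X is independent in M_q iff
-- dim (X ∩ φ(S)) ≤ |N(S)| for all S. By Kőnig's theorem again, this says that
-- every basis of X has an avoidance transversal of the spaces φ(Aᵢ).
--
-- For a representation, take a matrix G whose row i vanishes on Aᵢ and has its
-- other entries linearly independent over the field generated by the earlier
-- rows. Cutting U with the kernel of the first row lowers the dimension of
-- U ∩ φ(S) by one, unless U ∩ φ(S) lies in φ(S ∩ A₁); in both cases the condition
-- dim (U ∩ φ(S)) ≤ |N(S)| passes to the cut and the remaining rows, so G is
-- injective on independent spaces. Conversely G maps X ∩ φ(S) into the
-- coordinate space of N(S), which bounds the rank of G on X by the rank of X.
-- The fields are towers of quadratic extensions α² = α + r.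

module Submission where

open import Algebra.Bundles using (AbelianGroup; CommutativeRing)
import Algebra.Construct.DirectProduct as DirectProduct
import Algebra.Morphism.Construct.Composition as Composition
import Algebra.Morphism.Construct.Identity as Identity
open import Algebra.Morphism.Structures using (module RingMorphisms)
open import Level using (Level; _⊔_; Lift; lift; lower) renaming (suc to lsuc)
open import Data.Bool.Base using (true; false)
open import Data.Nat.Base as ℕ using (ℕ; zero; suc; _≤_; _<_; _^_; z≤n; s≤s)
import Data.Nat.Properties as ℕ
open import Data.Fin.Base using (Fin; zero; suc; inject≤; punchIn; punchOut; remQuot)
  renaming (combine to pair)
open import Data.Fin.Properties as Fin
  using (any?; injective⇒≤; suc-injective; 0≢1+n; punchOut-injective; punchIn-punchOut
        ; inject≤-injective; combine-remQuot; remQuot-combine)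
open import Data.Fin.Permutation as Perm
  using (Permutation′; _⟨$⟩ʳ_; insert; insert-punchIn)
open import Data.Fin.Subset
  using (Subset; inside; outside; ∣_∣; ⁅_⁆; _∪_; _-_; ∁; ⊤; ⊥)
  renaming (_∈_ to _∈ˢ_; _∉_ to _∉ˢ_; _⊆_ to _⊆ˢ_; _∩_ to _∩ˢ_)
open import Data.Fin.Subset.Properties
  using ( ∣p∣≤n; ∣p∣≡n⇒p≡⊤; ∣∁p∣≡n∸∣p∣; ∣⊥∣≡0; ∣⁅x⁆∣≡1; ∈⊤; ∉⊥; Empty-unique
        ; x∈∁p⇒x∉p; x∉p⇒x∈∁p; x∈⁅x⁆; x∈⁅y⁆⇒x≡y; nonempty?
        ; p⊆q⇒∣p∣≤∣q∣; p⊂q⇒∣p∣<∣q∣; p∩q⊆p; p∩q⊆q; x∈p∩q⁺; x∈p∩q⁻; p⊆p∪q; q⊆p∪q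
        ; x∈p∪q⁺; x∈p∪q⁻; p─q⊆p; x∈p∧x≢y⇒x∈p-y; x∈p⇒∣p-x∣<∣p∣ )
  renaming (_∈?_ to _∈ˢ?_; _⊆?_ to _⊆ˢ?_)
open import Data.List.Base as List using (List; []; _∷_; allFin; filter)
open import Data.List.Membership.Propositional using () renaming (_∈_ to _∈ᴸ_)
open import Data.List.Membership.Propositional.Properties using (∈-allFin; ∈-filter⁺; ∈-filter⁻)
open import Data.List.Relation.Unary.Any using (here; there)
open import Data.Product.Base using (Σ-syntax; ∃; ∃₂; _×_; _,_; proj₁; proj₂)
open import Data.Sum.Base using (_⊎_; inj₁; inj₂)
open import Data.Vec.Base using ([]; _∷_; tabulate; here; there)
open import Data.Vec.Properties using (lookup∘tabulate; []=⇒lookup; lookup⇒[]=)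
open import Data.Vec.Functional as VF using (Vector) renaming (_∷_ to infixr 5 _∷ᵥ_; [] to []ᵥ)
open import Function.Base using (_∘_; case_of_)
open import Function.Bundles using (Equivalence; Injection; Inverse; _⇔_; mk⇔)
open import Function.Definitions using (Injective)
open import Function.Properties.Inverse using (Inverse⇒Injection)
open import Relation.Binary.Bundles using (Setoid)
open import Relation.Binary.PropositionalEquality as ≡ using (_≡_; _≢_)
open import Relation.Nullary using (¬_; Dec; yes; no; contradiction; does)
open import Relation.Nullary.Decidable
  using (¬?; _×-dec_; decidable-stable; dec-true; dec-false; map′)
open import Relation.Unary using (Pred)
open import Defs

-- `IsCorrespondingMatroid` compares `M` and `Mq` on cyclic flats only, so every comparison of ranks
-- must first reach a cyclic flat of one of the two; the inequality carried along that walk is all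
-- of the rank formula that is used. Both conclusions then meet in the bound of dim (X ∩ φ(S)) by
-- |N(S)|, which mentions no rank function and makes sense over every field. The matrix depends on
-- this: a row with entries in an extension K′ of K cuts out of U ⊗ K′ a subspace that need not come
-- from K. So the induction on the rows ranges over all fields and all subspaces, and the matrix is
-- fixed before the subspace is chosen. The equation α² = α + r replaces α² = r because in
-- characteristic 2 every element of a finite field is a square, whereas y² - y takes the value 0
-- twice over every field. Degree 2 suffices, since a new entry only has to be independent of the
-- field below it.

private
  variable
    a b c ℓ : Level
    d h k l m n p p′ q : ℕ

-- Subsets of finite sets

elements : (P : Subset n) → Fin ∣ P ∣ → Fin n
elements (inside  ∷ P) zero    = zero
elements (inside  ∷ P) (suc i) = suc (elements P i)
elements (outside ∷ P) i       = suc (elements P i)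

elements-∈ : (P : Subset n) → ∀ i → elements P i ∈ˢ P
elements-∈ (inside  ∷ P) zero    = here
elements-∈ (inside  ∷ P) (suc i) = there (elements-∈ P i)
elements-∈ (outside ∷ P) i       = there (elements-∈ P i)

elements-injective : (P : Subset n) → Injective _≡_ _≡_ (elements P)
elements-injective (inside  ∷ P) {zero}  {zero}  _  = ≡.refl
elements-injective (inside  ∷ P) {suc i} {suc j} eq =
  ≡.cong suc (elements-injective P (suc-injective eq))
elements-injective (outside ∷ P) eq = elements-injective P (suc-injective eq)

elements-complete : (P : Subset n) → ∀ {x} → x ∈ˢ P → ∃ λ i → x ≡ elements P i
elements-complete (inside  ∷ P) here      = zero , ≡.refl
elements-complete (inside  ∷ P) (there x∈) with elements-complete P x∈
... | i , eq = suc i , ≡.cong suc eq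
elements-complete (outside ∷ P) (there x∈) with elements-complete P x∈
... | i , eq = i , ≡.cong suc eq

injective⇒≤∣∣ : (P : Subset n) (f : Fin m → Fin n) → Injective _≡_ _≡_ f →
                (∀ i → f i ∈ˢ P) → m ≤ ∣ P ∣
injective⇒≤∣∣ P f f-inj f∈ = injective⇒≤ {f = proj₁ ∘ position} λ {i} {j} eq →
  f-inj (≡.trans (proj₂ (position i))
    (≡.trans (≡.cong (elements P) eq) (≡.sym (proj₂ (position j)))))
  where
  position : ∀ i → ∃ λ j → f i ≡ elements P j
  position i = elements-complete P (f∈ i)

x∉p-x : (P : Subset n) (x : Fin n) → x ∉ˢ P - x
x∉p-x (inside  ∷ P) zero    ()
x∉p-x (outside ∷ P) zero    ()
x∉p-x (_       ∷ P) (suc x) (there x∈) = x∉p-x P x x∈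

x∈p-y⁻ : (P : Subset n) {x y : Fin n} → x ∈ˢ P - y → x ∈ˢ P × x ≢ y
x∈p-y⁻ P {y = y} x∈ = p─q⊆p P ⁅ y ⁆ x∈ , λ { ≡.refl → x∉p-x P y x∈ }

p⊆p-x∪x : (P : Subset n) (x : Fin n) → P ⊆ˢ (P - x) ∪ ⁅ x ⁆
p⊆p-x∪x P x {y} y∈ with y Fin.≟ x
... | yes ≡.refl = q⊆p∪q (P - x) ⁅ x ⁆ (x∈⁅x⁆ x)
... | no  y≢x    = p⊆p∪q ⁅ x ⁆ (x∈p∧x≢y⇒x∈p-y y∈ y≢x)

∣∪∣+∣∩∣ : (P Q : Subset n) → ∣ P ∪ Q ∣ ℕ.+ ∣ P ∩ˢ Q ∣ ≡ ∣ P ∣ ℕ.+ ∣ Q ∣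
∣∪∣+∣∩∣ []            []            = ≡.refl
∣∪∣+∣∩∣ (inside  ∷ P) (inside  ∷ Q) = ≡.cong suc
  (≡.trans (ℕ.+-suc _ _) (≡.trans (≡.cong suc (∣∪∣+∣∩∣ P Q)) (≡.sym (ℕ.+-suc _ _))))
∣∪∣+∣∩∣ (inside  ∷ P) (outside ∷ Q) = ≡.cong suc (∣∪∣+∣∩∣ P Q)
∣∪∣+∣∩∣ (outside ∷ P) (inside  ∷ Q) =
  ≡.trans (≡.cong suc (∣∪∣+∣∩∣ P Q)) (≡.sym (ℕ.+-suc _ _))
∣∪∣+∣∩∣ (outside ∷ P) (outside ∷ Q) = ∣∪∣+∣∩∣ P Q

∣p∪x∣≤ : (P : Subset n) (x : Fin n) → ∣ P ∪ ⁅ x ⁆ ∣ ≤ suc ∣ P ∣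
∣p∪x∣≤ P x = begin
  ∣ P ∪ ⁅ x ⁆ ∣                       ≤⟨ ℕ.m≤m+n _ _ ⟩
  ∣ P ∪ ⁅ x ⁆ ∣ ℕ.+ ∣ P ∩ˢ ⁅ x ⁆ ∣    ≡⟨ ∣∪∣+∣∩∣ P ⁅ x ⁆ ⟩
  ∣ P ∣ ℕ.+ ∣ ⁅ x ⁆ ∣                 ≡⟨ ≡.cong (∣ P ∣ ℕ.+_) (∣⁅x⁆∣≡1 x) ⟩
  ∣ P ∣ ℕ.+ 1                         ≡⟨ ℕ.+-comm ∣ P ∣ 1 ⟩
  suc ∣ P ∣                           ∎
  where open ℕ.≤-Reasoning

∣p∣<∣p∪x∣ : (P : Subset n) {x : Fin n} → x ∉ˢ P → ∣ P ∣ < ∣ P ∪ ⁅ x ⁆ ∣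
∣p∣<∣p∪x∣ P {x} x∉ =
  p⊂q⇒∣p∣<∣q∣ (p⊆p∪q ⁅ x ⁆ , x , q⊆p∪q P ⁅ x ⁆ (x∈⁅x⁆ x) , x∉)

select : {P : Pred (Fin n) ℓ} → (∀ i → Dec (P i)) → Subset n
select P? = tabulate (does ∘ P?)

module _ {P : Pred (Fin n) ℓ} (P? : ∀ i → Dec (P i)) where

  ∈-select⁺ : ∀ {i} → P i → i ∈ˢ select P?
  ∈-select⁺ {i} Pi = lookup⇒[]= i (select P?)
    (≡.trans (lookup∘tabulate (does ∘ P?) i) (dec-true (P? i) Pi))

  ∈-select⁻ : ∀ {i} → i ∈ˢ select P? → P i
  ∈-select⁻ {i} i∈ = decidable-stable (P? i) λ ¬Pi →
    case ≡.trans (≡.sym ([]=⇒lookup i∈))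
           (≡.trans (lookup∘tabulate (does ∘ P?) i) (dec-false (P? i) ¬Pi)) of λ ()

-- A transversal constrains only the first `m` values of the reordering `τ`, so an injective choice
-- of indices is enough. `f zero` is punched out of the codomain and the recursion permutes the
-- rest.
injection-extends : (m≤k : m ≤ k) (f : Fin m → Fin k) → Injective _≡_ _≡_ f →
                    Σ[ τ ∈ Permutation′ k ] ∀ i → τ ⟨$⟩ʳ inject≤ i m≤k ≡ f i
injection-extends {zero}          m≤k f f-inj = Perm.id , λ ()
injection-extends {suc m} {suc k} m≤k f f-inj =
  insert zero (f zero) (proj₁ ih) , λ where
    zero    → ≡.refl
    (suc i) → ≡.trans (insert-punchIn zero (f zero) (proj₁ ih) _)
      (≡.trans (≡.cong (punchIn (f zero)) (proj₂ ih i)) (punchIn-punchOut (f0≢ i)))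
  where
  f0≢ : ∀ i → f zero ≢ f (suc i)
  f0≢ i eq with f-inj eq
  ... | ()
  ih = injection-extends (ℕ.s≤s⁻¹ m≤k) (λ i → punchOut (f0≢ i)) λ {i} {j} eq →
    suc-injective (f-inj (punchOut-injective (f0≢ i) (f0≢ j) eq))

-- Kőnig's theorem

-- Row `i` has the neighbourhood `E i`; `X` holds the columns still free and `I` the matched rows.
-- Since `match` takes its column out of `X`, partners are distinct by construction.
data Matching {b} : ∀ {a} → Vector (Subset b) a → Subset b → Subset a → Set where
  []    : ∀ {E X} → Matching E X []
  skip  : ∀ {a E X I} → Matching {a = a} (E ∘ suc) X I → Matching E X (outside ∷ I)
  match : ∀ {a E X I x} → x ∈ˢ X → x ∈ˢ E zero →
          Matching {a = a} (E ∘ suc) (X - x) I → Matching E X (inside ∷ I)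

partner : ∀ {E : Vector (Subset n) m} {X I} → Matching E X I → Fin ∣ I ∣ → Fin n
partner (skip μ)            i       = partner μ i
partner (match {x = x} _ _ μ) zero    = x
partner (match _ _ μ)         (suc i) = partner μ i

partner-∈ : ∀ {E : Vector (Subset n) m} {X I} (μ : Matching E X I) →
            ∀ i → partner μ i ∈ˢ X
partner-∈ (skip μ)        i       = partner-∈ μ i
partner-∈ (match x∈ _ μ)  zero    = x∈
partner-∈ (match {X = X} _ _ μ) (suc i) = proj₁ (x∈p-y⁻ X (partner-∈ μ i))

partner-adjacent : ∀ {E : Vector (Subset n) m} {X I} (μ : Matching E X I) →
                   ∀ i → partner μ i ∈ˢ E (elements I i)
partner-adjacent (skip μ)       i       = partner-adjacent μ i
partner-adjacent (match _ x∈ μ) zero    = x∈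
partner-adjacent (match _ _ μ)  (suc i) = partner-adjacent μ i

partner-injective : ∀ {E : Vector (Subset n) m} {X I} (μ : Matching E X I) →
                    Injective _≡_ _≡_ (partner μ)
partner-injective (skip μ) eq = partner-injective μ eq
partner-injective (match _ _ μ) {zero}  {zero}  eq = ≡.refl
partner-injective (match {X = X} _ _ μ) {zero}  {suc j} eq =
  contradiction (≡.sym eq) (proj₂ (x∈p-y⁻ X (partner-∈ μ j)))
partner-injective (match {X = X} _ _ μ) {suc i} {zero}  eq =
  contradiction eq (proj₂ (x∈p-y⁻ X (partner-∈ μ i)))
partner-injective (match _ _ μ) {suc i} {suc j} eq =
  ≡.cong suc (partner-injective μ eq)

IsCover : Vector (Subset n) m → Subset n → Subset m → Subset n → Set
IsCover E X P Q = ∀ {i x} → x ∈ˢ X → x ∈ˢ E i → i ∈ˢ P ⊎ x ∈ˢ Q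

-- Weak duality: each matched edge uses up a member of the cover. If its row is not in `P`, its
-- column is in `Q` and leaves both `X` and `Q`.
∣matching∣≤∣cover∣ : ∀ {E : Vector (Subset n) m} {X I} → Matching E X I →
                     ∀ {P Q} → IsCover E X P Q → ∣ I ∣ ≤ ∣ P ∣ ℕ.+ ∣ Q ∣
∣matching∣≤∣cover∣ [] cov = z≤n
∣matching∣≤∣cover∣ {E = E} {X} (skip μ) {s ∷ P} {Q} cov =
  ℕ.≤-trans (∣matching∣≤∣cover∣ μ {P} tail-cover) (ℕ.+-monoˡ-≤ _ (grow s))
  where
  grow : ∀ s → ∣ P ∣ ≤ ∣ s ∷ P ∣
  grow inside  = ℕ.n≤1+n _
  grow outside = ℕ.≤-refl
  tail-cover : IsCover (E ∘ suc) X P Q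
  tail-cover x∈ x∈E with cov x∈ x∈E
  ... | inj₁ (there i∈) = inj₁ i∈
  ... | inj₂ x∈Q        = inj₂ x∈Q
∣matching∣≤∣cover∣ {E = E} {X} (match {x = x} x∈X x∈E μ) {inside ∷ P} {Q} cov =
  s≤s (∣matching∣≤∣cover∣ μ {P} tail-cover)
  where
  tail-cover : IsCover (E ∘ suc) (X - x) P Q
  tail-cover y∈ y∈E with cov (proj₁ (x∈p-y⁻ X y∈)) y∈E
  ... | inj₁ (there i∈) = inj₁ i∈
  ... | inj₂ y∈Q        = inj₂ y∈Q
∣matching∣≤∣cover∣ {E = E} {X} (match {x = x} x∈X x∈E μ) {outside ∷ P} {Q} cov
  with cov x∈X x∈E
... | inj₂ x∈Q = begin-strict
  _                       ≤⟨ ∣matching∣≤∣cover∣ μ {P} tail-cover ⟩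
  ∣ P ∣ ℕ.+ ∣ Q - x ∣     <⟨ ℕ.+-monoʳ-< ∣ P ∣ (x∈p⇒∣p-x∣<∣p∣ x∈Q) ⟩
  ∣ P ∣ ℕ.+ ∣ Q ∣         ∎
  where
  open ℕ.≤-Reasoning
  tail-cover : IsCover (E ∘ suc) (X - x) P (Q - x)
  tail-cover y∈ y∈E with cov (proj₁ (x∈p-y⁻ X y∈)) y∈E
  ... | inj₁ (there i∈) = inj₁ i∈
  ... | inj₂ y∈Q        = inj₂ (x∈p∧x≢y⇒x∈p-y y∈Q (proj₂ (x∈p-y⁻ X y∈)))

module _ {E : Vector (Subset n) m} {X : Subset n} {P P′ : Subset m} {Q Q′ : Subset n}
         (cov : IsCover E X P Q) (cov′ : IsCover E X P′ Q′) where

  cover-∩∪ : IsCover E X (P ∩ˢ P′) (Q ∪ Q′)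
  cover-∩∪ x∈ x∈E with cov x∈ x∈E | cov′ x∈ x∈E
  ... | inj₁ i∈ | inj₁ i∈′ = inj₁ (x∈p∩q⁺ (i∈ , i∈′))
  ... | inj₂ y∈ | _        = inj₂ (x∈p∪q⁺ (inj₁ y∈))
  ... | inj₁ _  | inj₂ y∈′ = inj₂ (x∈p∪q⁺ (inj₂ y∈′))

  cover-∪∩ : IsCover E X (P ∪ P′) (Q ∩ˢ Q′)
  cover-∪∩ x∈ x∈E with cov x∈ x∈E | cov′ x∈ x∈E
  ... | inj₁ i∈ | _        = inj₁ (x∈p∪q⁺ (inj₁ i∈))
  ... | inj₂ _  | inj₁ i∈′ = inj₁ (x∈p∪q⁺ (inj₂ i∈′))
  ... | inj₂ y∈ | inj₂ y∈′ = inj₂ (x∈p∩q⁺ (y∈ , y∈′))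

  -- The two merged covers have the same total size as the given ones, and
  -- neither can be smaller than a matching.
  merged-cover-minimum : ∀ {I} → Matching E X I →
    ∣ P ∣ ℕ.+ ∣ Q ∣ ≤ ∣ I ∣ → ∣ P′ ∣ ℕ.+ ∣ Q′ ∣ ≤ ∣ I ∣ →
    ∣ P ∩ˢ P′ ∣ ℕ.+ ∣ Q ∪ Q′ ∣ ≤ ∣ I ∣
  merged-cover-minimum {I} μ le le′ = ℕ.+-cancelʳ-≤ ∣ I ∣ _ _ (begin
    (∣ P ∩ˢ P′ ∣ ℕ.+ ∣ Q ∪ Q′ ∣) ℕ.+ ∣ I ∣
      ≤⟨ ℕ.+-monoʳ-≤ (∣ P ∩ˢ P′ ∣ ℕ.+ ∣ Q ∪ Q′ ∣) (∣matching∣≤∣cover∣ μ {P ∪ P′} cover-∪∩) ⟩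
    (∣ P ∩ˢ P′ ∣ ℕ.+ ∣ Q ∪ Q′ ∣) ℕ.+ (∣ P ∪ P′ ∣ ℕ.+ ∣ Q ∩ˢ Q′ ∣)
      ≡⟨ +-interchange (∣ P ∩ˢ P′ ∣) _ _ _ ⟩
    (∣ P ∩ˢ P′ ∣ ℕ.+ ∣ P ∪ P′ ∣) ℕ.+ (∣ Q ∪ Q′ ∣ ℕ.+ ∣ Q ∩ˢ Q′ ∣)
      ≡⟨ ≡.cong₂ ℕ._+_ (≡.trans (ℕ.+-comm ∣ P ∩ˢ P′ ∣ _) (∣∪∣+∣∩∣ P P′)) (∣∪∣+∣∩∣ Q Q′) ⟩
    (∣ P ∣ ℕ.+ ∣ P′ ∣) ℕ.+ (∣ Q ∣ ℕ.+ ∣ Q′ ∣)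
      ≡⟨ +-interchange (∣ P ∣) _ _ _ ⟩
    (∣ P ∣ ℕ.+ ∣ Q ∣) ℕ.+ (∣ P′ ∣ ℕ.+ ∣ Q′ ∣)
      ≤⟨ ℕ.+-mono-≤ le le′ ⟩
    ∣ I ∣ ℕ.+ ∣ I ∣
      ∎)
    where
    open ℕ.≤-Reasoning
    open import Algebra.Properties.CommutativeSemigroup ℕ.+-commutativeSemigroup
      using () renaming (interchange to +-interchange)

-- Induction on the rows. The head is matched to a column `x` whose loss does not shrink the
-- matching of the other rows, if there is one. Otherwise each neighbour of the head lies in some
-- minimum cover of the other rows. Merging intersects the row sides and unites the column sides, so
-- one minimum cover collects all these neighbours and covers the head for free.
kőnig : (E : Vector (Subset n) m) (X : Subset n) →
        ∃ λ I → Matching E X I ×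
          ∃₂ λ P Q → IsCover E X P Q × ∣ P ∣ ℕ.+ ∣ Q ∣ ≤ ∣ I ∣
kőnig {n} {zero} E X = [] , [] , [] , ⊥ , (λ {}) , ℕ.≤-reflexive (∣⊥∣≡0 n)
kőnig {n} {suc m} E X
  with kőnig (E ∘ suc) X
... | I , μ , P₀ , Q₀ , cov₀ , le₀
  with any? (λ x → x ∈ˢ? X ×-dec (x ∈ˢ? E zero ×-dec
              ∣ I ∣ ℕ.≤? ∣ proj₁ (kőnig (E ∘ suc) (X - x)) ∣))
-- The new edge is paid for by adding the head row to the cover `P₀`, `Q₀` of the other rows.
... | yes (x , x∈X , x∈E , le) =
  _ , match x∈X x∈E (proj₁ (proj₂ (kőnig (E ∘ suc) (X - x)))) ,
  inside ∷ P₀ , Q₀ , cover , s≤s (ℕ.≤-trans le₀ le)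
  where
  cover : IsCover E X (inside ∷ P₀) Q₀
  cover {zero}  _  _   = inj₁ here
  cover {suc i} x∈ x∈E with cov₀ x∈ x∈E
  ... | inj₁ i∈ = inj₁ (there i∈)
  ... | inj₂ y∈ = inj₂ y∈
... | no none = _ , skip μ , finish (merge (allFin n))
  where
  CoverThrough : List (Fin n) → Set
  CoverThrough xs = ∃₂ λ P Q → IsCover (E ∘ suc) X P Q × ∣ P ∣ ℕ.+ ∣ Q ∣ ≤ ∣ I ∣ ×
    (∀ {x} → x ∈ᴸ xs → x ∈ˢ X → x ∈ˢ E zero → x ∈ˢ Q)

  -- If the head cannot be matched to x, a minimum cover without x leaves room for x.
  through : ∀ x → x ∈ˢ X → x ∈ˢ E zero →
    ∃₂ λ P Q → IsCover (E ∘ suc) X P Q × ∣ P ∣ ℕ.+ ∣ Q ∣ ≤ ∣ I ∣ × x ∈ˢ Q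
  through x x∈X x∈E with kőnig (E ∘ suc) (X - x) in eq
  ... | I′ , μ′ , P , Q , cov , le =
    P , Q ∪ ⁅ x ⁆ , cover , bound , q⊆p∪q Q ⁅ x ⁆ (x∈⁅x⁆ x)
    where
    open ℕ.≤-Reasoning
    cover : IsCover (E ∘ suc) X P (Q ∪ ⁅ x ⁆)
    cover {x = y} y∈ y∈E with y Fin.≟ x
    ... | yes ≡.refl = inj₂ (q⊆p∪q Q ⁅ x ⁆ (x∈⁅x⁆ x))
    ... | no  y≢x with cov (x∈p∧x≢y⇒x∈p-y y∈ y≢x) y∈E
    ...   | inj₁ i∈ = inj₁ i∈
    ...   | inj₂ z∈ = inj₂ (p⊆p∪q ⁅ x ⁆ z∈)
    small : ∣ I′ ∣ < ∣ I ∣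
    small = ℕ.≰⇒> λ le′ → none
      (x , x∈X , x∈E , ≡.subst (λ r → ∣ I ∣ ≤ ∣ proj₁ r ∣) (≡.sym eq) le′)
    bound : ∣ P ∣ ℕ.+ ∣ Q ∪ ⁅ x ⁆ ∣ ≤ ∣ I ∣
    bound = begin
      ∣ P ∣ ℕ.+ ∣ Q ∪ ⁅ x ⁆ ∣ ≤⟨ ℕ.+-monoʳ-≤ ∣ P ∣ (∣p∪x∣≤ Q x) ⟩
      ∣ P ∣ ℕ.+ suc ∣ Q ∣     ≡⟨ ℕ.+-suc ∣ P ∣ ∣ Q ∣ ⟩
      suc (∣ P ∣ ℕ.+ ∣ Q ∣)   ≤⟨ s≤s le ⟩
      suc ∣ I′ ∣              ≤⟨ small ⟩
      ∣ I ∣                   ∎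

  merge : ∀ xs → CoverThrough xs
  merge []       = P₀ , Q₀ , cov₀ , le₀ , λ ()
  merge (x ∷ xs) with merge xs | x ∈ˢ? X | x ∈ˢ? E zero
  ... | P , Q , cov , le , thru | no x∉ | _ = P , Q , cov , le , λ where
    (here ≡.refl) x∈ → contradiction x∈ x∉
    (there y∈)       → thru y∈
  ... | P , Q , cov , le , thru | yes _ | no x∉ = P , Q , cov , le , λ where
    (here ≡.refl) _ x∈ → contradiction x∈ x∉
    (there y∈)         → thru y∈
  ... | P , Q , cov , le , thru | yes x∈X | yes x∈E with through x x∈X x∈E
  ...   | P′ , Q′ , cov′ , le′ , x∈Q′ =
    P ∩ˢ P′ , Q ∪ Q′ , cover-∩∪ cov cov′ , merged-cover-minimum cov cov′ μ le le′ ,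
    λ where
      (here ≡.refl) _ _ → q⊆p∪q Q Q′ x∈Q′
      (there y∈) y∈X y∈E → p⊆p∪q Q′ (thru y∈ y∈X y∈E)

  finish : CoverThrough (allFin n) →
    ∃₂ λ P Q → IsCover E X P Q × ∣ P ∣ ℕ.+ ∣ Q ∣ ≤ ∣ I ∣
  finish (P , Q , cov , le , thru) = outside ∷ P , Q , cover , le
    where
    cover : IsCover E X (outside ∷ P) Q
    cover {zero}  x∈ x∈E = inj₂ (thru (∈-allFin _) x∈ x∈E)
    cover {suc i} x∈ x∈E with cov x∈ x∈E
    ... | inj₁ i∈ = inj₁ (there i∈)
    ... | inj₂ y∈ = inj₂ y∈

-- Avoidance transversals

module _ (𝒜 : Vector (Subset n) k) where

  avoidable : Subset n → Subset k
  avoidable S = select λ i → ¬? (S ⊆ˢ? 𝒜 i)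

  ∈-avoidable⁺ : ∀ S {i} → ¬ S ⊆ˢ 𝒜 i → i ∈ˢ avoidable S
  ∈-avoidable⁺ S = ∈-select⁺ λ i → ¬? (S ⊆ˢ? 𝒜 i)

  ∈-avoidable⁻ : ∀ S {i} → i ∈ˢ avoidable S → ¬ S ⊆ˢ 𝒜 i
  ∈-avoidable⁻ S = ∈-select⁻ λ i → ¬? (S ⊆ˢ? 𝒜 i)

  avoidable-mono : ∀ {S T} → S ⊆ˢ T → avoidable S ⊆ˢ avoidable T
  avoidable-mono {S} {T} S⊆T i∈ =
    ∈-avoidable⁺ T λ T⊆ → ∈-avoidable⁻ S i∈ λ s∈ → T⊆ (S⊆T s∈)

module _ (𝒜 : Vector (Subset n) (suc k)) (S : Subset n) where

  ∣avoidable∣-suc : ∣ avoidable 𝒜 S ∣ ≤ suc ∣ avoidable (𝒜 ∘ suc) S ∣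
  ∣avoidable∣-suc with does (S ⊆ˢ? 𝒜 zero)
  ... | true  = ℕ.n≤1+n _
  ... | false = ℕ.≤-refl

  ∣avoidable∣-skip : S ⊆ˢ 𝒜 zero → ∣ avoidable 𝒜 S ∣ ≤ ∣ avoidable (𝒜 ∘ suc) S ∣
  ∣avoidable∣-skip S⊆ with S ⊆ˢ? 𝒜 zero
  ... | yes _  = ℕ.≤-refl
  ... | no  S⊈ = contradiction (λ {x} → S⊆ {x}) S⊈

module _ {U : Setoid a ℓ} where
  open Setoid U using () renaming (Carrier to |U|)

  module _ {A : Vector (Pred |U| b) k} {X : Pred |U| c} where

    matching⇒transversal : (u : Vector |U| m) → IsOrdering U X u →
      (y : Fin m → Fin k) → Injective _≡_ _≡_ y → (∀ i → ¬ A (y i) (u i)) →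
      HasAvoidanceTransversal U A X
    matching⇒transversal {m} u u-ord y y-inj avoids = record
      { x        = u
      ; ordering = u-ord
      ; size≤k   = m≤k
      ; τ        = proj₁ τ,ext
      ; avoids   = λ i → ≡.subst (λ j → ¬ A j (u i)) (≡.sym (proj₂ τ,ext i)) (avoids i)
      }
      where
      m≤k : m ≤ k
      m≤k = injective⇒≤ y-inj
      τ,ext = injection-extends m≤k y y-inj

    module _ (T : HasAvoidanceTransversal U A X) where
      open HasAvoidanceTransversal T

      avoided : Fin size → Fin k
      avoided i = τ ⟨$⟩ʳ inject≤ i size≤k

      avoided-injective : Injective _≡_ _≡_ avoided
      avoided-injective eq = inject≤-injective size≤k size≤k _ _
        (Injection.injective (Inverse⇒Injection τ) eq)

-- Matroids

module MatroidProperties (M : Matroid n) where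
  open Matroid M

  r-∪-≤ : ∀ X Y → r (X ∪ Y) ≤ r X ℕ.+ ∣ Y ∣
  r-∪-≤ X Y = ℕ.≤-trans (ℕ.m≤m+n _ _)
    (ℕ.≤-trans (submodular X Y) (ℕ.+-monoʳ-≤ (r X) (bounded Y)))

  r-∪⁅⁆-≤ : ∀ X x → r (X ∪ ⁅ x ⁆) ≤ suc (r X)
  r-∪⁅⁆-≤ X x = begin
    r (X ∪ ⁅ x ⁆)         ≤⟨ r-∪-≤ X ⁅ x ⁆ ⟩
    r X ℕ.+ ∣ ⁅ x ⁆ ∣     ≡⟨ ≡.cong (r X ℕ.+_) (∣⁅x⁆∣≡1 x) ⟩
    r X ℕ.+ 1             ≡⟨ ℕ.+-comm (r X) 1 ⟩
    suc (r X)             ∎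
    where open ℕ.≤-Reasoning

  r-≤-suc-r- : ∀ X x → r X ≤ suc (r (X - x))
  r-≤-suc-r- X x = ℕ.≤-trans (monotone (p⊆p-x∪x X x)) (r-∪⁅⁆-≤ (X - x) x)

  -- Take a basis `I` of `X - x` and add `x` only if the rank rises. If it does not, apply
  -- submodularity to `I ∪ ⁅ x ⁆` and `X - x`: their union contains `X` and their intersection
  -- contains `I`.
  basisOf : ∀ X → ∃ λ I → I ⊆ˢ X × Independent I × r X ≤ r I
  basisOf X = go ∣ X ∣ X ℕ.≤-refl
    where
    go : ∀ d X → ∣ X ∣ ≤ d → ∃ λ I → I ⊆ˢ X × Independent I × r X ≤ r I
    go d X ∣X∣≤d with nonempty? X
    ... | no empty = X , (λ x∈ → x∈) ,
      ℕ.≤-antisym (bounded X) (ℕ.≤-trans (ℕ.≤-reflexive ∣X∣≡0) z≤n) , ℕ.≤-refl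
      where
      ∣X∣≡0 : ∣ X ∣ ≡ 0
      ∣X∣≡0 = ≡.trans (≡.cong ∣_∣ (Empty-unique empty)) (∣⊥∣≡0 n)
    go zero    X ∣X∣≤d | yes (x , x∈) =
      contradiction (ℕ.≤-trans (x∈p⇒∣p-x∣<∣p∣ x∈) ∣X∣≤d) λ ()
    go (suc d) X ∣X∣≤d | yes (x , x∈)
      with go d (X - x) (ℕ.s≤s⁻¹ (ℕ.≤-trans (x∈p⇒∣p-x∣<∣p∣ x∈) ∣X∣≤d))
    ... | I , I⊆ , I-indep , r≤ with r (I ∪ ⁅ x ⁆) ℕ.≤? r I
    ... | yes le = I , (λ y∈ → proj₁ (x∈p-y⁻ X (I⊆ y∈))) , I-indep ,
      ℕ.+-cancelʳ-≤ (r I) _ _ (begin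
        r X ℕ.+ r I
          ≤⟨ ℕ.+-mono-≤ (monotone X⊆) (monotone I⊆∩) ⟩
        r ((I ∪ ⁅ x ⁆) ∪ (X - x)) ℕ.+ r ((I ∪ ⁅ x ⁆) ∩ˢ (X - x))
          ≤⟨ submodular (I ∪ ⁅ x ⁆) (X - x) ⟩
        r (I ∪ ⁅ x ⁆) ℕ.+ r (X - x)
          ≤⟨ ℕ.+-mono-≤ le r≤ ⟩
        r I ℕ.+ r I
          ∎)
      where
      open ℕ.≤-Reasoning
      X⊆ : X ⊆ˢ (I ∪ ⁅ x ⁆) ∪ (X - x)
      X⊆ {y} y∈ with y Fin.≟ x
      ... | yes ≡.refl = p⊆p∪q (X - x) (q⊆p∪q I ⁅ x ⁆ (x∈⁅x⁆ x))
      ... | no  y≢x    = q⊆p∪q (I ∪ ⁅ x ⁆) (X - x) (x∈p∧x≢y⇒x∈p-y y∈ y≢x)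
      I⊆∩ : I ⊆ˢ (I ∪ ⁅ x ⁆) ∩ˢ (X - x)
      I⊆∩ y∈ = x∈p∩q⁺ (p⊆p∪q ⁅ x ⁆ y∈ , I⊆ y∈)
    ... | no ≰ = I ∪ ⁅ x ⁆ , I∪x⊆ ,
      ℕ.≤-antisym (bounded _) (begin
        ∣ I ∪ ⁅ x ⁆ ∣   ≤⟨ ∣p∪x∣≤ I x ⟩
        suc ∣ I ∣       ≡⟨ ≡.cong suc I-indep ⟨
        suc (r I)       ≤⟨ ℕ.≰⇒> ≰ ⟩
        r (I ∪ ⁅ x ⁆)   ∎) ,
      (begin
        r X             ≤⟨ r-≤-suc-r- X x ⟩
        suc (r (X - x)) ≤⟨ s≤s r≤ ⟩
        suc (r I)       ≤⟨ ℕ.≰⇒> ≰ ⟩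
        r (I ∪ ⁅ x ⁆)   ∎)
      where
      open ℕ.≤-Reasoning
      I∪x⊆ : I ∪ ⁅ x ⁆ ⊆ˢ X
      I∪x⊆ y∈ with x∈p∪q⁻ I ⁅ x ⁆ y∈
      ... | inj₁ y∈I = proj₁ (x∈p-y⁻ X (I⊆ y∈I))
      ... | inj₂ y∈x with x∈⁅y⁆⇒x≡y x y∈x
      ...   | ≡.refl = x∈

  -- Start from Z = X; adding an element that does not raise the rank of Z, or
  -- removing one that lowers it, preserves the inequality, and the pair
  -- (r Z , n ∸ ∣ Z ∣) decreases lexicographically.
  ¬¬-cyclicFlat : ∀ X →
    ¬ (∀ Z → CyclicFlat Z → ¬ r Z ℕ.+ ∣ X ∣ ≤ r X ℕ.+ ∣ X ∩ˢ Z ∣)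
  ¬¬-cyclicFlat X none = go (r X) n X ℕ.≤-refl (ℕ.m≤m+n n _)
    (ℕ.+-monoʳ-≤ (r X) (p⊆q⇒∣p∣≤∣q∣ {p = X} {X ∩ˢ X} λ x∈ → x∈p∩q⁺ (x∈ , x∈)))
    where
    open ℕ.≤-Reasoning
    Good : Subset n → Set
    Good Z = r Z ℕ.+ ∣ X ∣ ≤ r X ℕ.+ ∣ X ∩ˢ Z ∣

    good-∪ : ∀ {Z s} → r (Z ∪ ⁅ s ⁆) ≤ r Z → Good Z → Good (Z ∪ ⁅ s ⁆)
    good-∪ {Z} {s} le good = begin
      r (Z ∪ ⁅ s ⁆) ℕ.+ ∣ X ∣         ≤⟨ ℕ.+-monoˡ-≤ _ le ⟩
      r Z ℕ.+ ∣ X ∣                   ≤⟨ good ⟩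
      r X ℕ.+ ∣ X ∩ˢ Z ∣              ≤⟨ ℕ.+-monoʳ-≤ (r X) (p⊆q⇒∣p∣≤∣q∣ ∩⊆) ⟩
      r X ℕ.+ ∣ X ∩ˢ (Z ∪ ⁅ s ⁆) ∣    ∎
      where
      ∩⊆ : X ∩ˢ Z ⊆ˢ X ∩ˢ (Z ∪ ⁅ s ⁆)
      ∩⊆ y∈ = let y∈X , y∈Z = x∈p∩q⁻ X Z y∈ in x∈p∩q⁺ (y∈X , p⊆p∪q ⁅ s ⁆ y∈Z)

    -- The left side drops by at least one with the rank of `Z`, the right side by at most one with
    -- the intersection.
    good-- : ∀ {Z x} → r (Z - x) < r Z → Good Z → Good (Z - x)
    good-- {Z} {x} lt good = ℕ.s≤s⁻¹ (begin
      suc (r (Z - x) ℕ.+ ∣ X ∣)               ≤⟨ ℕ.+-monoˡ-≤ _ lt ⟩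
      r Z ℕ.+ ∣ X ∣                           ≤⟨ good ⟩
      r X ℕ.+ ∣ X ∩ˢ Z ∣                      ≤⟨ ℕ.+-monoʳ-≤ (r X) (p⊆q⇒∣p∣≤∣q∣ ∩⊆) ⟩
      r X ℕ.+ ∣ (X ∩ˢ (Z - x)) ∪ ⁅ x ⁆ ∣      ≤⟨ ℕ.+-monoʳ-≤ (r X) (∣p∪x∣≤ (X ∩ˢ (Z - x)) x) ⟩
      r X ℕ.+ suc ∣ X ∩ˢ (Z - x) ∣            ≡⟨ ℕ.+-suc (r X) _ ⟩
      suc (r X ℕ.+ ∣ X ∩ˢ (Z - x) ∣)          ∎)
      where
      ∩⊆ : X ∩ˢ Z ⊆ˢ (X ∩ˢ (Z - x)) ∪ ⁅ x ⁆
      ∩⊆ y∈ with x∈p∩q⁻ X Z y∈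
      ... | y∈X , y∈Z with x∈p∪q⁻ (Z - x) ⁅ x ⁆ (p⊆p-x∪x Z x y∈Z)
      ...   | inj₁ y∈- = p⊆p∪q ⁅ x ⁆ (x∈p∩q⁺ (y∈X , y∈-))
      ...   | inj₂ y∈x = q⊆p∪q (X ∩ˢ (Z - x)) ⁅ x ⁆ y∈x

    go      : ∀ u d Z → r Z ≤ u → n ≤ d ℕ.+ ∣ Z ∣ → ¬ Good Z
    enlarge : ∀ u d {Z s} → s ∉ˢ Z → r (Z ∪ ⁅ s ⁆) ≤ r Z →
              r Z ≤ u → n ≤ d ℕ.+ ∣ Z ∣ → ¬ Good Z
    shrink  : ∀ u {Z x} → r (Z - x) < r Z → r Z ≤ u → ¬ Good Z

    go u d Z rZ≤u n≤ good = none Z (flat , cyclic) good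
      where
      flat : Flat Z
      flat s∉ = ℕ.≰⇒> λ le → enlarge u d s∉ le rZ≤u n≤ good
      cyclic : Cyclic Z
      cyclic {x} x∈ = ℕ.≤-antisym (monotone (p─q⊆p Z ⁅ x ⁆))
        (ℕ.≮⇒≥ λ lt → shrink u lt rZ≤u good)

    enlarge u zero {Z} {s} s∉ le rZ≤u n≤ good =
      ℕ.<⇒≱ (∣p∣<∣p∪x∣ Z s∉) (ℕ.≤-trans (∣p∣≤n (Z ∪ ⁅ s ⁆)) n≤)
    enlarge u (suc d) {Z} {s} s∉ le rZ≤u n≤ good =
      go u d (Z ∪ ⁅ s ⁆) (ℕ.≤-trans le rZ≤u) (begin
        n                           ≤⟨ n≤ ⟩
        suc d ℕ.+ ∣ Z ∣             ≡⟨ ℕ.+-suc d _ ⟨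
        d ℕ.+ suc ∣ Z ∣             ≤⟨ ℕ.+-monoʳ-≤ d (∣p∣<∣p∪x∣ Z s∉) ⟩
        d ℕ.+ ∣ Z ∪ ⁅ s ⁆ ∣         ∎) (good-∪ le good)

    shrink zero    lt rZ≤u = contradiction (ℕ.≤-trans lt rZ≤u) λ ()
    shrink (suc u) {Z} {x} lt rZ≤u good =
      -- `d` restarts at `n`, since the bound `u` on the rank has decreased.
      go u n (Z - x) (ℕ.s≤s⁻¹ (ℕ.≤-trans lt rZ≤u)) (ℕ.m≤m+n n _) (good-- lt good)

  module Transversal {k} (𝒜 : Vector (Subset n) k)
    (presents : ∀ X → Independent X ⇔ HasAvoidanceTransversal (≡.setoid (Fin n))
                        (λ i → _∈ˢ 𝒜 i) (_∈ˢ X)) where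

    -- In a transversal of a basis of `S`, each index belongs to a set that misses a point of `S`,
    -- and the indices are distinct.
    r≤∣avoidable∣ : ∀ S → r S ≤ ∣ avoidable 𝒜 S ∣
    r≤∣avoidable∣ S with basisOf S
    ... | I , I⊆S , I-indep , rS≤rI = begin
      r S                 ≤⟨ rS≤rI ⟩
      r I                 ≡⟨ I-indep ⟩
      ∣ I ∣               ≤⟨ injective⇒≤ position-injective ⟩
      size                ≤⟨ injective⇒≤∣∣ (avoidable 𝒜 S) (avoided T) (avoided-injective T)
                               (λ i → ∈-avoidable⁺ 𝒜 S λ S⊆ → avoids i (S⊆ (I⊆S (listed i)))) ⟩
      ∣ avoidable 𝒜 S ∣   ∎
      where
      open ℕ.≤-Reasoning
      T = Equivalence.to (presents I) I-indep
      open HasAvoidanceTransversal T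
      open IsOrdering ordering
      position : Fin ∣ I ∣ → Fin size
      position i = proj₁ (complete (elements-∈ I i))
      position-injective : Injective _≡_ _≡_ position
      position-injective {i} {j} eq = elements-injective I
        (≡.trans (proj₂ (complete (elements-∈ I i)))
          (≡.trans (≡.cong x eq) (≡.sym (proj₂ (complete (elements-∈ I j))))))

    -- In a minimum cover of the incidences between S and 𝒜, the elements of S
    -- that are used would be coloops of S; so there are none.
    cyclic⇒∣avoidable∣≤r : ∀ S → Cyclic S → ∣ avoidable 𝒜 S ∣ ≤ r S
    cyclic⇒∣avoidable∣≤r S S-cyclic
      -- Rows are points and columns are indices of `𝒜`. Intersecting with `S` leaves the points
      -- outside `S` without neighbours, since the empty set lies in every `𝒜 i`.
      with kőnig {k} {n} (λ s → avoidable 𝒜 (⁅ s ⁆ ∩ˢ S)) ⊤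
    ... | I , μ , P , Q , cov , ∣P∣+∣Q∣≤∣I∣ = conclude (nonempty? (P ∩ˢ S))
      where
      open ℕ.≤-Reasoning
      adjacent⁺ : ∀ {s i} → s ∈ˢ S → s ∉ˢ 𝒜 i → i ∈ˢ avoidable 𝒜 (⁅ s ⁆ ∩ˢ S)
      adjacent⁺ {s} s∈S s∉A = ∈-avoidable⁺ 𝒜 _ λ ⊆A → s∉A (⊆A (x∈p∩q⁺ (x∈⁅x⁆ s , s∈S)))

      adjacent⁻ : ∀ {s i} → i ∈ˢ avoidable 𝒜 (⁅ s ⁆ ∩ˢ S) → s ∈ˢ S × s ∉ˢ 𝒜 i
      adjacent⁻ {s} {i} i∈ = decidable-stable (s ∈ˢ? S) (λ s∉S → ⊈ (λ t∈ → contradiction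
          (≡.subst (_∈ˢ S) (x∈⁅y⁆⇒x≡y s (p∩q⊆p ⁅ s ⁆ S t∈)) (p∩q⊆q ⁅ s ⁆ S t∈)) s∉S)) ,
        λ s∈A → ⊈ λ t∈ →
          ≡.subst (_∈ˢ 𝒜 i) (≡.sym (x∈⁅y⁆⇒x≡y s (p∩q⊆p ⁅ s ⁆ S t∈))) s∈A
        where
        ⊈ : ¬ ⁅ s ⁆ ∩ˢ S ⊆ˢ 𝒜 i
        ⊈ = ∈-avoidable⁻ 𝒜 _ i∈

      I⊆S : I ⊆ˢ S
      I⊆S x∈ with elements-complete I x∈
      ... | i , ≡.refl = proj₁ (adjacent⁻ (partner-adjacent μ i))

      I-independent : Independent I
      I-independent = Equivalence.from (presents I) (matching⇒transversal (elements I)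
        (record { distinct = elements-injective I
                ; listed   = elements-∈ I
                ; complete = elements-complete I })
        (partner μ) (partner-injective μ) λ i → proj₂ (adjacent⁻ (partner-adjacent μ i)))

      ∣I∣≤rS : ∣ I ∣ ≤ r S
      ∣I∣≤rS = ℕ.≤-trans (ℕ.≤-reflexive (≡.sym I-independent)) (monotone I⊆S)

      -- Applied to `S` with the empty set as `P′` when the cover uses no point of `S`, and to
      -- `S - x` with `P - x` when it uses `x`.
      covered : ∀ T P′ → T ⊆ˢ S → (∀ {s} → s ∈ˢ T → s ∈ˢ P → s ∈ˢ P′) →
                avoidable 𝒜 (T ∩ˢ ∁ P′) ⊆ˢ Q
      covered T P′ T⊆S P∩T⊆P′ {i} i∈ = decidable-stable (i ∈ˢ? Q) λ i∉Q →
        ∈-avoidable⁻ 𝒜 _ i∈ λ {s} s∈ → decidable-stable (s ∈ˢ? 𝒜 i) λ s∉A →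
          let s∈T , s∈∁P′ = x∈p∩q⁻ T (∁ P′) s∈ in
          case cov ∈⊤ (adjacent⁺ (T⊆S s∈T) s∉A) of λ where
            (inj₁ s∈P) → x∈∁p⇒x∉p s∈∁P′ (P∩T⊆P′ s∈T s∈P)
            (inj₂ i∈Q) → i∉Q i∈Q

      -- A cover bounds the rank: points of `P′` count one each, and the remaining points of `T`
      -- have all their indices in `Q`.
      r-bound : ∀ {T} P′ → avoidable 𝒜 (T ∩ˢ ∁ P′) ⊆ˢ Q → r T ≤ ∣ P′ ∣ ℕ.+ ∣ Q ∣
      r-bound {T} P′ ⊆Q = begin
        r T                                           ≤⟨ monotone T⊆ ⟩
        r ((T ∩ˢ ∁ P′) ∪ P′)                          ≤⟨ r-∪-≤ (T ∩ˢ ∁ P′) P′ ⟩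
        r (T ∩ˢ ∁ P′) ℕ.+ ∣ P′ ∣                      ≤⟨ ℕ.+-monoˡ-≤ _ (r≤∣avoidable∣ _) ⟩
        ∣ avoidable 𝒜 (T ∩ˢ ∁ P′) ∣ ℕ.+ ∣ P′ ∣        ≤⟨ ℕ.+-monoˡ-≤ _ (p⊆q⇒∣p∣≤∣q∣ ⊆Q) ⟩
        ∣ Q ∣ ℕ.+ ∣ P′ ∣                              ≡⟨ ℕ.+-comm (∣ Q ∣) _ ⟩
        ∣ P′ ∣ ℕ.+ ∣ Q ∣                              ∎
        where
        T⊆ : T ⊆ˢ (T ∩ˢ ∁ P′) ∪ P′
        T⊆ {x} x∈ with x ∈ˢ? P′
        ... | yes x∈P′ = q⊆p∪q (T ∩ˢ ∁ P′) P′ x∈P′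
        ... | no  x∉P′ = p⊆p∪q P′ (x∈p∩q⁺ (x∈ , x∉p⇒x∈∁p x∉P′))

      conclude : Dec (∃ λ x → x ∈ˢ P ∩ˢ S) → ∣ avoidable 𝒜 S ∣ ≤ r S
      conclude (no none) = begin
        ∣ avoidable 𝒜 S ∣       ≤⟨ p⊆q⇒∣p∣≤∣q∣ (λ i∈ → covered S ⊥ (λ s∈ → s∈)
          (λ s∈S s∈P → contradiction (_ , x∈p∩q⁺ (s∈P , s∈S)) none) (avoidable-mono 𝒜 S⊆ i∈)) ⟩
        ∣ Q ∣                   ≤⟨ ℕ.m≤n+m (∣ Q ∣) _ ⟩
        ∣ P ∣ ℕ.+ ∣ Q ∣         ≤⟨ ∣P∣+∣Q∣≤∣I∣ ⟩
        ∣ I ∣                   ≤⟨ ∣I∣≤rS ⟩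
        r S                     ∎
        where
        S⊆ : S ⊆ˢ S ∩ˢ ∁ ⊥
        S⊆ s∈ = x∈p∩q⁺ (s∈ , x∉p⇒x∈∁p ∉⊥)
      conclude (yes (x , x∈)) = contradiction (begin-strict
        r S                       ≡⟨ S-cyclic x∈S ⟨
        r (S - x)                 ≤⟨ r-bound (P - x) (covered (S - x) (P - x) (λ s∈ → proj₁ (x∈p-y⁻ S s∈))
                                       λ s∈ s∈P → x∈p∧x≢y⇒x∈p-y s∈P (proj₂ (x∈p-y⁻ S s∈))) ⟩
        ∣ P - x ∣ ℕ.+ ∣ Q ∣       <⟨ ℕ.+-monoˡ-< _ (x∈p⇒∣p-x∣<∣p∣ x∈P) ⟩
        ∣ P ∣ ℕ.+ ∣ Q ∣           ≤⟨ ∣P∣+∣Q∣≤∣I∣ ⟩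
        ∣ I ∣                     ≤⟨ ∣I∣≤rS ⟩
        r S                       ∎) (ℕ.<-irrefl ≡.refl)
        where
        x∈P = proj₁ (x∈p∩q⁻ P S x∈)
        x∈S = proj₂ (x∈p∩q⁻ P S x∈)

-- Linear algebra over a finite field

module LinearAlgebraProperties {c ℓ q} (F : FiniteField c ℓ q) where
  open FiniteField F hiding (zero)
  open LinearAlgebra F
  open Subspace
  open import Algebra.Properties.Ring ring using (-‿distribˡ-*)
  open import Relation.Binary.Reasoning.Setoid setoid

  combine-zero : (s : V k) (b : Vector (V n) k) → ∀ {j} → (∀ i → b i j ≈ 0#) →
                 combine s b j ≈ 0#
  combine-zero {zero}  s b b≈0 = refl
  combine-zero {suc k} s b {j} b≈0 = begin
    s zero * b zero j + combine (s ∘ suc) (b ∘ suc) j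
      ≈⟨ +-cong (*-congˡ (b≈0 zero)) (combine-zero (s ∘ suc) (b ∘ suc) (b≈0 ∘ suc)) ⟩
    s zero * 0# + 0#  ≈⟨ +-identityʳ _ ⟩
    s zero * 0#       ≈⟨ zeroʳ _ ⟩
    0#                ∎

  span-least : (X : Subspace n) (b : Vector (V n) k) → (∀ i → b i ∈ X) → span b ⊆ X
  span-least X b b∈ (s , v≋) = resp X (≋-sym v≋) (combine∈ X b b∈ s)

  ∈span : (b : Vector (V n) k) → ∀ i → b i ∈ span b
  ∈span b zero    = head∈ (b zero) (b ∘ suc)
  ∈span b (suc i) = shift (b zero) (b ∘ suc) (∈span (b ∘ suc) i)

  -- By counting: the q^k combinations of `b` are distinct and each is determined by its
  -- coefficients over `b′`.
  independent≤span : (b : Vector (V n) k) (b′ : Vector (V n) l) →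
    LinearlyIndependent b → (∀ i → b i ∈ span b′) → k ≤ l
  independent≤span {k = k} {l = l} b b′ indep b∈ =
    ℕ.≮⇒≥ λ l<k → ℕ.<⇒≱ (ℕ.^-monoʳ-< q 1<q l<k) (injective⇒≤ f-injective)
    where
    coords : ∀ s → combine s b ∈ span b′
    coords = combine∈ (span b′) b b∈
    f : Fin (q ^ k) → Fin (q ^ l)
    f i = index (proj₁ (coords (vector i)))
    f-injective : Injective _≡_ _≡_ f
    f-injective {i} {j} eq = vector-injective (combine-injective b indep
      (≋-trans (proj₂ (coords (vector i)))
        (≋-trans (combine-cong b′ (index-injective eq))
          (≋-sym (proj₂ (coords (vector j)))))))

  basisOf : (X : Subspace n) → Vector (V n) (dim X)
  basisOf X = proj₁ (proj₂ (basis X))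

  module BasisOf {n} (X : Subspace n) = IsBasis (proj₂ (proj₂ (basis X)))

  module _ (X : Subspace n) where
    private
      module B = BasisOf X

    dim≤ : (b : Vector (V n) k) → X ⊆ span b → dim X ≤ k
    dim≤ b X⊆ = independent≤span (basisOf X) b B.independent λ i → X⊆ (B.contained i)

    independent≤dim : (b : Vector (V n) k) → LinearlyIndependent b →
                      (∀ i → b i ∈ X) → k ≤ dim X
    independent≤dim b indep b∈ = independent≤span b (basisOf X) indep λ i → B.spanning (b∈ i)

    independent-spans : (b : Vector (V n) k) → LinearlyIndependent b →
                        (∀ i → b i ∈ X) → dim X ≤ k → X ⊆ span b
    independent-spans b indep b∈ dim≤k {v} v∈ with v ∈? span b
    ... | yes v∈b = v∈b
    ... | no  v∉b = contradiction dim≤k (ℕ.<⇒≱ (independent≤dim (v ∷ᵥ b)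
      (extend {v = v} {b} indep v∉b)
      λ where zero → v∈ ; (suc i) → b∈ i))

    basis⊆⇒⊆ : (Y : Subspace n) → (∀ i → basisOf X i ∈ Y) → X ⊆ Y
    basis⊆⇒⊆ Y b∈ v∈ = span-least Y (basisOf X) b∈ (B.spanning v∈)

  dim-mono : (X Y : Subspace n) → X ⊆ Y → dim X ≤ dim Y
  dim-mono X Y X⊆Y = dim≤ X (basisOf Y) λ v∈ → BasisOf.spanning Y (X⊆Y v∈)

  dim-strict : (X Y : Subspace n) → X ⊆ Y → ∀ {v} → v ∈ Y → v ∉ X → dim X < dim Y
  dim-strict X Y X⊆Y {v} v∈Y v∉X = independent≤dim Y (v ∷ᵥ basisOf X)
    (extend {v = v} {basisOf X} B.independent
      λ v∈ → v∉X (span-least X (basisOf X) B.contained {v} v∈))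
    λ where zero → v∈Y ; (suc i) → X⊆Y (B.contained i)
    where module B = BasisOf X

  dim≤0⇒≋0 : (X : Subspace n) → dim X ≤ 0 → ∀ {v} → v ∈ X → v ≋ 0ᵥ
  dim≤0⇒≋0 X dim≤0 v∈ = proj₂ (independent-spans X []ᵥ (λ _ _ ()) (λ ()) dim≤0 v∈)

  -- The original family stays a literal tail, so bounds can be carried along one new vector at a
  -- time, as in `ρ-prolongs` and `T-prolongs`.
  data Prolongs {k} (b : Vector (V n) k) : ∀ l → Vector (V n) (l ℕ.+ k) → Set c where
    base : Prolongs b 0 b
    step : ∀ {l b′} v → Prolongs b l b′ → Prolongs b (suc l) (v ∷ᵥ b′)

  prolongs-index : {b : Vector (V n) k} {b′ : Vector (V n) (l ℕ.+ k)} → Prolongs b l b′ →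
                   ∀ i → ∃ λ j → b i ≡ b′ j
  prolongs-index base       i = i , ≡.refl
  prolongs-index (step v P) i with prolongs-index P i
  ... | j , eq = suc j , eq

  prolong : (X : Subspace n) {b : Vector (V n) k} → LinearlyIndependent b →
            (∀ i → b i ∈ X) → ∃₂ λ l b′ → Prolongs b l b′ × IsBasis X b′
  prolong {n} {k} X {b} b-indep b∈X with go (vector {n})
    where
    go : (w : Vector (V n) m) → ∃₂ λ l b′ → Prolongs b l b′ × (∀ i → b′ i ∈ X) ×
           LinearlyIndependent b′ × (∀ i → w i ∈ X → w i ∈ span b′)
    go {zero}  w = 0 , b , base , b∈X , b-indep , λ ()
    go {suc m} w with go (w ∘ suc)
    ... | l , b′ , P , b′∈ , indep , covers with w zero ∈? X | w zero ∈? span b′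
    ...   | no w∉X | _ = l , b′ , P , b′∈ , indep , λ where
      zero    w∈X → contradiction w∈X w∉X
      (suc i) → covers i
    ...   | yes _ | yes w∈b = l , b′ , P , b′∈ , indep , λ where
      zero    _ → w∈b
      (suc i) → covers i
    ...   | yes w∈X | no w∉b =
      suc l , w zero ∷ᵥ b′ , step (w zero) P ,
      (λ where zero → w∈X ; (suc i) → b′∈ i) , extend {v = w zero} {b′} indep w∉b , λ where
        zero    _   → head∈ (w zero) b′
        (suc i) wᵢ∈ → shift (w zero) b′ (covers i wᵢ∈)
  ... | l , b′ , P , b′∈ , indep , covers = l , b′ , P , record
    { contained   = b′∈
    ; independent = indep
    ; spanning    = λ {v} v∈ → resp (span b′) (vector-index v)
        (covers (index v) (resp X (≋-sym (vector-index v)) v∈))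
    }

  ⊆⊕ˡ : (X Y : Subspace n) → X ⊆ X ⊕ Y
  ⊆⊕ˡ X Y {v} v∈ = v , 0ᵥ , v∈ , zeroᵐ Y , λ i → sym (+-identityʳ (v i))

  ⊆⊕ʳ : (X Y : Subspace n) → Y ⊆ X ⊕ Y
  ⊆⊕ʳ X Y {v} v∈ = 0ᵥ , v , zeroᵐ X , v∈ , λ i → sym (+-identityˡ (v i))

  ⊕-least : (X Y Z : Subspace n) → X ⊆ Z → Y ⊆ Z → X ⊕ Y ⊆ Z
  ⊕-least X Y Z X⊆ Y⊆ (x , y , x∈ , y∈ , v≋) = resp Z (≋-sym v≋) (addᵐ Z (X⊆ x∈) (Y⊆ y∈))

  v∈⟨v⟩ : (v : V n) → v ∈ ⟨ v ⟩
  v∈⟨v⟩ v = head∈ v []ᵥ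

  ⟨⟩-least : (X : Subspace n) {v : V n} → v ∈ X → ⟨ v ⟩ ⊆ X
  ⟨⟩-least X {v} v∈ = span-least X (v ∷ᵥ []ᵥ) λ where zero → v∈

  span-∷⊆ : (v : V n) (b : Vector (V n) k) (X : Subspace n) → v ∈ X → span b ⊆ X →
            span (v ∷ᵥ b) ⊆ X
  span-∷⊆ v b X v∈ b⊆ = span-least X (v ∷ᵥ b) λ where
    zero    → v∈
    (suc i) → b⊆ {b i} (∈span b i)

  dim⟨⟩≤1 : (v : V n) → dim ⟨ v ⟩ ≤ 1
  dim⟨⟩≤1 v = dim≤ ⟨ v ⟩ (v ∷ᵥ []ᵥ) λ {u} u∈ → u∈

  -- If `X ∩ Z` is not inside `H`, pick `v` in it outside `H`. Then `v` and `H` span `Z`, and the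
  -- part in `H` of a vector of `X ∩ Z` stays in `X` because `v` does.
  dim-∩-hyperplane : (X Z H : Subspace n) → H ⊆ Z → suc (dim H) ≡ dim Z →
                     dim (X ∩ Z) ≤ suc (dim (X ∩ H))
  dim-∩-hyperplane X Z H H⊆Z codim1
    with Fin.all? (λ i → basisOf (X ∩ Z) i ∈? H)
  ... | yes all = ℕ.m≤n⇒m≤1+n (dim-mono (X ∩ Z) (X ∩ H)
    λ {v} v∈ → proj₁ v∈ , basis⊆⇒⊆ (X ∩ Z) H all {v} v∈)
  ... | no ¬all with Fin.¬∀⟶∃¬ _ _ (λ i → basisOf (X ∩ Z) i ∈? H) ¬all
  ... | i , v∉H = dim≤ (X ∩ Z) (v ∷ᵥ bXH) (λ {u} → spanned {u})
    where
    v = basisOf (X ∩ Z) i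
    v∈X∩Z = BasisOf.contained (X ∩ Z) i
    bH = basisOf H
    module H = BasisOf H
    bXH = basisOf (X ∩ H)
    module XH = BasisOf (X ∩ H)

    Z⊆ : Z ⊆ span (v ∷ᵥ bH)
    Z⊆ = independent-spans Z (v ∷ᵥ bH)
      (extend {v = v} {bH} H.independent λ v∈ → v∉H (span-least H bH H.contained {v} v∈))
      (λ where zero → proj₂ v∈X∩Z ; (suc j) → H⊆Z (H.contained j))
      (ℕ.≤-reflexive (≡.sym codim1))

    spanned : X ∩ Z ⊆ span (v ∷ᵥ bXH)
    spanned {u} (u∈X , u∈Z) with Z⊆ {u} u∈Z
    ... | s , u≋ = resp (span (v ∷ᵥ bXH)) (≋-sym u≋)
      (addᵐ (span (v ∷ᵥ bXH)) {s zero *ᵥ v} {w}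
        (scaleᵐ (span (v ∷ᵥ bXH)) (s zero) {v} (head∈ v bXH))
        (shift v bXH (XH.spanning {w} (w∈X , combine∈ H bH H.contained (s ∘ suc)))))
      where
      w = combine (s ∘ suc) bH
      w∈X : w ∈ X
      w∈X = resp X {u +ᵥ (- s zero) *ᵥ v} {w} (λ j → begin
        u j + - s zero * v j                      ≈⟨ +-cong (u≋ j) (sym (-‿distribˡ-* _ _)) ⟩
        (s zero * v j + w j) + - (s zero * v j)   ≈⟨ +-congʳ (+-comm _ _) ⟩
        (w j + s zero * v j) + - (s zero * v j)   ≈⟨ +-assoc _ _ _ ⟩
        w j + (s zero * v j + - (s zero * v j))   ≈⟨ +-congˡ (-‿inverseʳ _) ⟩
        w j + 0#                                  ≈⟨ +-identityʳ _ ⟩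
        w j                                       ∎)
        (addᵐ X u∈X (scaleᵐ X (- s zero) (proj₁ v∈X∩Z)))

  e-diagonal : (i : Fin n) → e i i ≈ 1#
  e-diagonal i with i Fin.≟ i
  ... | yes _  = refl
  ... | no i≢i = contradiction ≡.refl i≢i

  e-off-diagonal : (i j : Fin n) → i ≢ j → e i j ≈ 0#
  e-off-diagonal i j i≢j with i Fin.≟ j
  ... | yes i≡j = contradiction i≡j i≢j
  ... | no  _   = refl

  combine-e : (s : V k) (f : Fin k → Fin n) → Injective _≡_ _≡_ f →
              ∀ i → combine s (e ∘ f) (f i) ≈ s i
  combine-e s f f-inj zero = begin
    s zero * e (f zero) (f zero) + combine (s ∘ suc) (e ∘ f ∘ suc) (f zero)
      ≈⟨ +-cong (*-congˡ (e-diagonal (f zero)))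
          (combine-zero (s ∘ suc) (e ∘ f ∘ suc) λ j → e-off-diagonal (f (suc j)) (f zero) λ eq → 0≢1+n (≡.sym (f-inj eq))) ⟩
    s zero * 1# + 0#  ≈⟨ +-identityʳ _ ⟩
    s zero * 1#       ≈⟨ *-identityʳ _ ⟩
    s zero            ∎
  combine-e s f f-inj (suc i) = begin
    s zero * e (f zero) (f (suc i)) + combine (s ∘ suc) (e ∘ f ∘ suc) (f (suc i))
      ≈⟨ +-cong (*-congˡ (e-off-diagonal (f zero) (f (suc i)) λ eq → 0≢1+n (f-inj eq)))
          (combine-e (s ∘ suc) (f ∘ suc) (λ eq → suc-injective (f-inj eq)) i) ⟩
    s zero * 0# + s (suc i)  ≈⟨ +-congʳ (zeroʳ _) ⟩
    0# + s (suc i)           ≈⟨ +-identityˡ _ ⟩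
    s (suc i)                ∎

  SupportedOn : Subset n → V n → Set ℓ
  SupportedOn S v = ∀ {j} → j ∉ˢ S → v j ≈ 0#

  support : V n → Subset n
  support v = select λ j → ¬? (v j ≟ 0#)

  ∈-support⁺ : (v : V n) → ∀ {j} → v j ≉ 0# → j ∈ˢ support v
  ∈-support⁺ v = ∈-select⁺ λ j → ¬? (v j ≟ 0#)

  ∈-support⁻ : (v : V n) → ∀ {j} → j ∈ˢ support v → v j ≉ 0#
  ∈-support⁻ v = ∈-select⁻ λ j → ¬? (v j ≟ 0#)

  supported⇒∈span : (S : Subset n) {v : V n} → SupportedOn S v → v ∈ span (e ∘ elements S)
  supported⇒∈span S {v} v-supp = v ∘ elements S , agree
    where
    agree : v ≋ combine (v ∘ elements S) (e ∘ elements S)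
    agree j with j ∈ˢ? S
    ... | no j∉ = trans (v-supp j∉) (sym (combine-zero _ (e ∘ elements S) λ i →
      e-off-diagonal (elements S i) j λ { ≡.refl → j∉ (elements-∈ S i) }))
    ... | yes j∈ with elements-complete S j∈
    ...   | i , ≡.refl = sym (combine-e (v ∘ elements S) (elements S) (elements-injective S) i)

  e∈φ : (S : Subset n) {i : Fin n} → i ∈ˢ S → e i ∈ φ S
  e∈φ {n} S {i} i∈ = listed (filter (_∈ˢ? S) (allFin n))
    (∈-filter⁺ (_∈ˢ? S) (∈-allFin i) i∈)
    where
    listed : ∀ xs → i ∈ᴸ xs → e i ∈ span (VF.fromList (List.map e xs))
    listed (x ∷ xs) (here ≡.refl) = head∈ (e x) (VF.fromList (List.map e xs))
    listed (x ∷ xs) (there i∈)    = shift (e x) (VF.fromList (List.map e xs)) (listed xs i∈)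

  ∈φ⁺ : (S : Subset n) {v : V n} → SupportedOn S v → v ∈ φ S
  ∈φ⁺ S {v} v-supp = span-least (φ S) (e ∘ elements S) (e∈φ S ∘ elements-∈ S) {v}
    (supported⇒∈span S v-supp)

  ∈φ⁻ : (S : Subset n) {v : V n} → v ∈ φ S → SupportedOn S v
  ∈φ⁻ {n} S {v} (s , v≋) {j} j∉ = trans (v≋ j)
    (vanish (filter (_∈ˢ? S) (allFin n)) s
      λ i∈ → λ { ≡.refl → j∉ (proj₂ (∈-filter⁻ (_∈ˢ? S) {xs = allFin n} i∈)) })
    where
    vanish : ∀ xs s → (∀ {i} → i ∈ᴸ xs → i ≢ j) →
             combine s (VF.fromList (List.map e xs)) j ≈ 0#
    vanish []       s xs≢j = refl
    vanish (x ∷ xs) s xs≢j = trans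
      (+-cong (trans (*-congˡ (e-off-diagonal x j (xs≢j (here ≡.refl)))) (zeroʳ _))
        (vanish xs (s ∘ suc) (xs≢j ∘ there)))
      (+-identityˡ 0#)

  φ-mono : {S T : Subset n} → S ⊆ˢ T → φ S ⊆ φ T
  φ-mono {S = S} {T} S⊆T {v} v∈ = ∈φ⁺ T {v} λ j∉ → ∈φ⁻ S {v} v∈ (j∉ ∘ S⊆T)

  support⊆⇒∈φ : (v : V n) (S : Subset n) → support v ⊆ˢ S → v ∈ φ S
  support⊆⇒∈φ v S ⊆S = ∈φ⁺ S {v} λ {j} j∉ → decidable-stable (v j ≟ 0#) λ vⱼ≉0 →
    j∉ (⊆S (∈-support⁺ v vⱼ≉0))

  ∈φ⇒support⊆ : (v : V n) (S : Subset n) → v ∈ φ S → support v ⊆ˢ S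
  ∈φ⇒support⊆ v S v∈ {j} j∈ = decidable-stable (j ∈ˢ? S) λ j∉ →
    ∈-support⁻ v j∈ (∈φ⁻ S {v} v∈ j∉)

  dim-φ≤ : (S : Subset n) → dim (φ S) ≤ ∣ S ∣
  dim-φ≤ S = dim≤ (φ S) (e ∘ elements S) λ {v} v∈ → supported⇒∈span S {v} (∈φ⁻ S {v} v∈)

  e-independent : (f : Fin k → Fin n) → Injective _≡_ _≡_ f → LinearlyIndependent (e ∘ f)
  e-independent f f-inj s eq i = trans (sym (combine-e s f f-inj i)) (eq (f i))

  dim≤n : (X : Subspace n) → dim X ≤ n
  dim≤n X = dim≤ X e λ {v} _ → v , λ j → sym (combine-e v (λ i → i) (λ eq → eq) j)

  open import Algebra.Properties.Semiring.Sum semiring using (sum; sum-cong-≋)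

  -- Row rank is at most column rank: the coefficients of the columns over `P` form `p` rows that
  -- span the rows of `A`.
  rank≤ : (A : Matrix h k) (P : Vector (V h) p) →
          (∀ j → (λ i → A i j) ∈ span P) → rank A ≤ p
  rank≤ A P columns = dim≤ (rowSpace A) C (λ {v} → span-least (span C) A (λ i →
    (λ t → P t i) , λ j → trans (proj₂ (columns j) i) (sum-cong-≋ λ t → *-comm _ (P t i))) {v})
    where
    C : Vector (V _) _
    C t j = proj₁ (columns j) t

  -- The same factorisation read backwards, from a basis of the row space.
  columns∈ : (A : Matrix h k) → ∃ λ (P : Vector (V h) (rank A)) →
             ∀ j → (λ i → A i j) ∈ span P
  columns∈ A = (λ t i → proj₁ (rows i) t) ,
    λ j → (λ t → basisOf (rowSpace A) t j) , λ i → trans (proj₂ (rows i) j)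
      (sum-cong-≋ λ t → *-comm (proj₁ (rows i) t) (basisOf (rowSpace A) t j))
    where
    rows : ∀ i → A i ∈ span (basisOf (rowSpace A))
    rows i = BasisOf.spanning (rowSpace A) (∈span A i)

  combine-single : (s : V k) (b : Vector (V n) k) (i : Fin k) → s i ≈ 1# →
                   (∀ j → i ≢ j → s j ≈ 0#) → combine s b ≋ b i
  combine-single s b zero sᵢ≈1 s≈0 j = begin
    s zero * b zero j + combine (s ∘ suc) (b ∘ suc) j
      ≈⟨ +-cong (*-congʳ sᵢ≈1) (combine-cong (b ∘ suc) (λ i → s≈0 (suc i) 0≢1+n) j) ⟩
    1# * b zero j + combine 0ᵥ (b ∘ suc) j  ≈⟨ +-cong (*-identityˡ _) (combine-0 (b ∘ suc) j) ⟩
    b zero j + 0#                           ≈⟨ +-identityʳ _ ⟩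
    b zero j                                ∎
  combine-single s b (suc i) sᵢ≈1 s≈0 j = begin
    s zero * b zero j + combine (s ∘ suc) (b ∘ suc) j
      ≈⟨ +-cong (*-congʳ (s≈0 zero λ eq → 0≢1+n (≡.sym eq)))
          (combine-single (s ∘ suc) (b ∘ suc) i sᵢ≈1
            (λ l i≢l → s≈0 (suc l) (i≢l ∘ suc-injective)) j) ⟩
    0# * b zero j + b (suc i) j  ≈⟨ +-congʳ (zeroˡ _) ⟩
    0# + b (suc i) j             ≈⟨ +-identityˡ _ ⟩
    b (suc i) j                  ∎

  combine-eˡ : (b : Vector (V n) k) (i : Fin k) → combine (e i) b ≋ b i
  combine-eˡ b i = combine-single (e i) b i (e-diagonal i) (e-off-diagonal i)

  combine-combine : (s : V k) (t : Vector (V l) k) (b : Vector (V n) l) →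
                    combine (combine s t) b ≋ combine s (λ i → combine (t i) b)
  combine-combine {zero}  s t b = combine-0 b
  combine-combine {suc k} s t b j = begin
    combine (s zero *ᵥ t zero +ᵥ combine (s ∘ suc) (t ∘ suc)) b j
      ≈⟨ combine-+ (s zero *ᵥ t zero) (combine (s ∘ suc) (t ∘ suc)) b j ⟩
    combine (s zero *ᵥ t zero) b j + combine (combine (s ∘ suc) (t ∘ suc)) b j
      ≈⟨ +-cong (combine-* (s zero) (t zero) b j) (combine-combine (s ∘ suc) (t ∘ suc) b j) ⟩
    s zero * combine (t zero) b j + combine (s ∘ suc) (λ i → combine (t (suc i)) b) j
      ∎

  combine-congʳ : (s : V k) {b b′ : Vector (V n) k} → (∀ i → b i ≋ b′ i) →
                  combine s b ≋ combine s b′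
  combine-congʳ s b≋b′ j = sum-cong-≋ λ i → *-congˡ (b≋b′ i j)

  -- `combine s (e ∘ f)` pads the coefficients with zeros to a relation on the whole family.
  independent-∘ : (b : Vector (V n) l) → LinearlyIndependent b →
                  (f : Fin k → Fin l) → Injective _≡_ _≡_ f → LinearlyIndependent (b ∘ f)
  independent-∘ b indep f f-inj s eq i = trans (sym (combine-e s f f-inj i))
    (indep (combine s (e ∘ f)) (λ j → trans (combine-combine s (e ∘ f) b j)
      (trans (combine-congʳ s (λ i → combine-eˡ b (f i)) j) (eq j))) (f i))

  independent⇒distinct : (b : Vector (V n) k) → LinearlyIndependent b →
                         ∀ {i j} → b i ≋ b j → i ≡ j
  independent⇒distinct b indep {i} {j} bᵢ≋bⱼ = decidable-stable (i Fin.≟ j) λ i≢j →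
    0≉1 (trans (sym (e-off-diagonal j i (i≢j ∘ ≡.sym))) (trans
      (combine-injective b indep {e j} {e i} (≋-trans (combine-eˡ b j)
        (≋-trans (≋-sym bᵢ≋bⱼ) (≋-sym (combine-eˡ b i)))) i)
      (e-diagonal i)))

  -- The product is a combination of vectors with a single entry, so closure follows from linearity
  -- of `combine`. `Lift` raises the equation to the level of `Member`.
  annihilator : V n → Subspace n
  annihilator g = record
    { Member  = λ v → Lift c (dot v ≈ 0#)
    ; member? = λ v → map′ lift lower (dot v ≟ 0#)
    ; resp    = λ {v} {w} eq (lift v⊥) →
        lift (trans (combine-cong column (≋-sym eq) zero) v⊥)
    ; zeroᵐ   = lift (combine-0 column zero)
    ; addᵐ    = λ {v} {w} (lift v⊥) (lift w⊥) →
        lift (trans (combine-+ v w column zero) (trans (+-cong v⊥ w⊥) (+-identityʳ 0#)))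
    ; scaleᵐ  = λ x {v} (lift v⊥) →
        lift (trans (combine-* x v column zero) (trans (*-congˡ v⊥) (zeroʳ x)))
    }
    where
    column : Vector (V 1) _
    column i _ = g i
    dot : V _ → Carrier
    dot v = combine v column zero

-- q-Matroids

module QMatroidProperties {c ℓ q} {F : FiniteField c ℓ q} (Mq : QMatroid F n) where
  open LinearAlgebra F
  open LinearAlgebraProperties F
  open QMatroid Mq

  ρ-⊕-⟨⟩≤ : ∀ X v → ρ (X ⊕ ⟨ v ⟩) ≤ suc (ρ X)
  ρ-⊕-⟨⟩≤ X v = begin
    ρ (X ⊕ ⟨ v ⟩)                       ≤⟨ ℕ.m≤m+n _ _ ⟩
    ρ (X ⊕ ⟨ v ⟩) ℕ.+ ρ (X ∩ ⟨ v ⟩)     ≤⟨ submodular X ⟨ v ⟩ ⟩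
    ρ X ℕ.+ ρ ⟨ v ⟩                     ≤⟨ ℕ.+-monoʳ-≤ (ρ X) (ℕ.≤-trans (bounded ⟨ v ⟩) (dim⟨⟩≤1 v)) ⟩
    ρ X ℕ.+ 1                           ≡⟨ ℕ.+-comm (ρ X) 1 ⟩
    suc (ρ X)                           ∎
    where open ℕ.≤-Reasoning

  span-∷⊆⊕ : (v : V n) (b : Vector (V n) k) → span (v ∷ᵥ b) ⊆ span b ⊕ ⟨ v ⟩
  span-∷⊆⊕ v b {u} = span-∷⊆ v b (span b ⊕ ⟨ v ⟩)
    (⊆⊕ʳ (span b) ⟨ v ⟩ {v} (v∈⟨v⟩ v)) (λ {w} → ⊆⊕ˡ (span b) ⟨ v ⟩ {w}) {u}

  ρ-span-∷≤ : (v : V n) (b : Vector (V n) k) → ρ (span (v ∷ᵥ b)) ≤ suc (ρ (span b))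
  ρ-span-∷≤ v b = ℕ.≤-trans
    (monotone (span (v ∷ᵥ b)) (span b ⊕ ⟨ v ⟩) (λ {u} → span-∷⊆⊕ v b {u}))
    (ρ-⊕-⟨⟩≤ (span b) v)

  ρ-prolongs : {b : Vector (V n) k} {b′ : Vector (V n) (l ℕ.+ k)} →
               Prolongs b l b′ → ρ (span b′) ≤ l ℕ.+ ρ (span b)
  ρ-prolongs base                = ℕ.≤-refl
  ρ-prolongs (step {b′ = b′} v P) = ℕ.≤-trans (ρ-span-∷≤ v b′) (s≤s (ρ-prolongs P))

  -- Nullity, `dim` minus `ρ`, is monotone: each vector that prolongs a basis of `Y` to one of `X`
  -- raises the rank by at most one.
  ρ+dim≤ : ∀ X Y → Y ⊆ X → ρ X ℕ.+ dim Y ≤ ρ Y ℕ.+ dim X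
  ρ+dim≤ X Y Y⊆X with prolong X (BasisOf.independent Y) (λ i → Y⊆X (BasisOf.contained Y i))
  ... | l , b , P , B = begin
    ρ X ℕ.+ dim Y                             ≤⟨ ℕ.+-monoˡ-≤ _ (monotone X (span b) B.spanning) ⟩
    ρ (span b) ℕ.+ dim Y                      ≤⟨ ℕ.+-monoˡ-≤ _ (ρ-prolongs P) ⟩
    (l ℕ.+ ρ (span (basisOf Y))) ℕ.+ dim Y    ≤⟨ ℕ.+-monoˡ-≤ _ (ℕ.+-monoʳ-≤ l (monotone (span (basisOf Y)) Y
      λ {v} → span-least Y (basisOf Y) (BasisOf.contained Y) {v})) ⟩
    (l ℕ.+ ρ Y) ℕ.+ dim Y                     ≡⟨ ≡.cong (ℕ._+ dim Y) (ℕ.+-comm l (ρ Y)) ⟩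
    (ρ Y ℕ.+ l) ℕ.+ dim Y                     ≡⟨ ℕ.+-assoc (ρ Y) l _ ⟩
    ρ Y ℕ.+ (l ℕ.+ dim Y)                     ≡⟨ ≡.cong (ρ Y ℕ.+_) (dim-unique X B) ⟨
    ρ Y ℕ.+ dim X                             ∎
    where
    open ℕ.≤-Reasoning
    module B = IsBasis B

  independent-⊆ : ∀ X Y → Independent X → Y ⊆ X → Independent Y
  independent-⊆ X Y X-indep Y⊆X = ℕ.≤-antisym (bounded Y)
    (ℕ.+-cancelʳ-≤ (dim X) _ _ (begin
      dim Y ℕ.+ dim X   ≡⟨ ≡.cong (dim Y ℕ.+_) X-indep ⟨
      dim Y ℕ.+ ρ X     ≡⟨ ℕ.+-comm (dim Y) _ ⟩
      ρ X ℕ.+ dim Y     ≤⟨ ρ+dim≤ X Y Y⊆X ⟩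
      ρ Y ℕ.+ dim X     ∎))
    where open ℕ.≤-Reasoning

  dim-⊕-⟨⟩≤ : (X : Subspace n) (v : V n) → dim (X ⊕ ⟨ v ⟩) ≤ suc (dim X)
  dim-⊕-⟨⟩≤ X v = dim≤ (X ⊕ ⟨ v ⟩) (v ∷ᵥ basisOf X) λ {u} → ⊕-least X ⟨ v ⟩ (span (v ∷ᵥ basisOf X))
    (λ {w} w∈ → shift v (basisOf X) {w} (BasisOf.spanning X w∈))
    (λ {w} → ⟨⟩-least (span (v ∷ᵥ basisOf X)) {v} (head∈ v (basisOf X)) {w}) {u}

  -- Basis vectors of `X` are added one at a time, only when they raise the rank. When `b zero` does
  -- not, submodularity for `Y ⊕ ⟨ b zero ⟩` and the span of the other vectors shows that `Y` still
  -- has full rank.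
  basisSubspace : ∀ X → ∃ λ Y → Y ⊆ X × Independent Y × ρ X ≤ ρ Y
  basisSubspace X with go (basisOf X)
    where
    go : (b : Vector (V n) k) → ∃ λ Y → Y ⊆ span b × Independent Y × ρ (span b) ≤ ρ Y
    go {zero} b = span b , (λ v∈ → v∈) , ℕ.≤-antisym (bounded (span b))
      (ℕ.≤-trans (dim≤ (span b) b λ {v} v∈ → v∈) z≤n) , ℕ.≤-refl
    go {suc k} b with go (b ∘ suc)
    ... | Y , Y⊆ , Y-indep , ρ≤ with ρ (Y ⊕ ⟨ b zero ⟩) ℕ.≤? ρ Y
    ... | yes le = Y , (λ {v} v∈ → shift (b zero) (b ∘ suc) {v} (Y⊆ v∈)) , Y-indep ,
      ℕ.+-cancelʳ-≤ (ρ Y) _ _ (begin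
        ρ (span b) ℕ.+ ρ Y            ≤⟨ ℕ.+-mono-≤ (monotone (span b) (Y′ ⊕ S) (λ {v} → ⊆Y′⊕S {v}))
                                          (monotone Y (Y′ ∩ S) λ {v} v∈ → ⊆⊕ˡ Y ⟨ b zero ⟩ {v} v∈ , Y⊆ v∈) ⟩
        ρ (Y′ ⊕ S) ℕ.+ ρ (Y′ ∩ S)     ≤⟨ submodular Y′ S ⟩
        ρ Y′ ℕ.+ ρ S                  ≤⟨ ℕ.+-mono-≤ le ρ≤ ⟩
        ρ Y ℕ.+ ρ Y                   ∎)
      where
      open ℕ.≤-Reasoning
      Y′ = Y ⊕ ⟨ b zero ⟩
      S  = span (b ∘ suc)
      ⊆Y′⊕S : span b ⊆ Y′ ⊕ S
      ⊆Y′⊕S {v} = span-∷⊆ (b zero) (b ∘ suc) (Y′ ⊕ S)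
        (⊆⊕ˡ Y′ S {b zero} (⊆⊕ʳ Y ⟨ b zero ⟩ {b zero} (v∈⟨v⟩ (b zero))))
        (λ {w} → ⊆⊕ʳ Y′ S {w}) {v}
    ... | no ≰ = Y ⊕ ⟨ b zero ⟩ , (λ {v} → Y′⊆ {v}) ,
      ℕ.≤-antisym (bounded (Y ⊕ ⟨ b zero ⟩)) (begin
        dim (Y ⊕ ⟨ b zero ⟩)    ≤⟨ dim-⊕-⟨⟩≤ Y (b zero) ⟩
        suc (dim Y)             ≡⟨ ≡.cong suc Y-indep ⟨
        suc (ρ Y)               ≤⟨ ℕ.≰⇒> ≰ ⟩
        ρ (Y ⊕ ⟨ b zero ⟩)      ∎) ,
      (begin
        ρ (span b)              ≤⟨ ρ-span-∷≤ (b zero) (b ∘ suc) ⟩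
        suc (ρ (span (b ∘ suc))) ≤⟨ s≤s ρ≤ ⟩
        suc (ρ Y)               ≤⟨ ℕ.≰⇒> ≰ ⟩
        ρ (Y ⊕ ⟨ b zero ⟩)      ∎)
      where
      open ℕ.≤-Reasoning
      Y′⊆ : Y ⊕ ⟨ b zero ⟩ ⊆ span b
      Y′⊆ {v} = ⊕-least Y ⟨ b zero ⟩ (span b)
        (λ {w} w∈ → shift (b zero) (b ∘ suc) {w} (Y⊆ w∈))
        (λ {w} → ⟨⟩-least (span b) {b zero} (head∈ (b zero) (b ∘ suc)) {w}) {v}
  ... | Y , Y⊆ , Y-indep , ρ≤ =
    Y , (λ {v} v∈ → span-least X (basisOf X) (BasisOf.contained X) {v} (Y⊆ v∈)) , Y-indep ,
    ℕ.≤-trans (monotone X (span (basisOf X)) (BasisOf.spanning X)) ρ≤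

  -- The walk of MatroidProperties.¬¬-cyclicFlat, with vectors and hyperplanes
  -- in place of elements. Hyperplanes are not enumerated, so Z is only found up
  -- to double negation; it is used for decidable inequalities only.
  ¬¬-cyclicFlat : ∀ X →
    ¬ (∀ Z → CyclicFlat Z → ¬ ρ Z ℕ.+ dim X ≤ ρ X ℕ.+ dim (X ∩ Z))
  ¬¬-cyclicFlat X none = go (ρ X) n X ℕ.≤-refl (ℕ.m≤m+n n _)
    (ℕ.+-monoʳ-≤ (ρ X) (dim-mono X (X ∩ X) λ x∈ → x∈ , x∈))
    where
    open ℕ.≤-Reasoning
    Good : Subspace n → Set
    Good Z = ρ Z ℕ.+ dim X ≤ ρ X ℕ.+ dim (X ∩ Z)

    good-⊕ : ∀ Z v → ρ (Z ⊕ ⟨ v ⟩) ≤ ρ Z → Good Z → Good (Z ⊕ ⟨ v ⟩)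
    good-⊕ Z v le good = begin
      ρ (Z ⊕ ⟨ v ⟩) ℕ.+ dim X             ≤⟨ ℕ.+-monoˡ-≤ _ le ⟩
      ρ Z ℕ.+ dim X                       ≤⟨ good ⟩
      ρ X ℕ.+ dim (X ∩ Z)                 ≤⟨ ℕ.+-monoʳ-≤ (ρ X) (dim-mono (X ∩ Z) (X ∩ (Z ⊕ ⟨ v ⟩))
        λ {u} (u∈X , u∈Z) → u∈X , ⊆⊕ˡ Z ⟨ v ⟩ {u} u∈Z) ⟩
      ρ X ℕ.+ dim (X ∩ (Z ⊕ ⟨ v ⟩))       ∎

    good-hyperplane : ∀ Z H → H ⊆ Z → suc (dim H) ≡ dim Z → ρ H < ρ Z → Good Z → Good H
    good-hyperplane Z H H⊆Z codim1 lt good = ℕ.s≤s⁻¹ (begin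
      suc (ρ H ℕ.+ dim X)             ≤⟨ ℕ.+-monoˡ-≤ _ lt ⟩
      ρ Z ℕ.+ dim X                   ≤⟨ good ⟩
      ρ X ℕ.+ dim (X ∩ Z)             ≤⟨ ℕ.+-monoʳ-≤ (ρ X) (dim-∩-hyperplane X Z H H⊆Z codim1) ⟩
      ρ X ℕ.+ suc (dim (X ∩ H))       ≡⟨ ℕ.+-suc (ρ X) _ ⟩
      suc (ρ X ℕ.+ dim (X ∩ H))       ∎)

    go      : ∀ u d Z → ρ Z ≤ u → n ≤ d ℕ.+ dim Z → ¬ Good Z
    enlarge : ∀ u d Z v → v ∉ Z → ρ (Z ⊕ ⟨ v ⟩) ≤ ρ Z →
              ρ Z ≤ u → n ≤ d ℕ.+ dim Z → ¬ Good Z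
    shrink  : ∀ u Z H → H ⊆ Z → suc (dim H) ≡ dim Z → ρ H < ρ Z → ρ Z ≤ u → ¬ Good Z

    go u d Z ρZ≤u n≤ good = none Z (flat , cyclic) good
      where
      flat : Flat Z
      flat {v} v∉ = ℕ.≰⇒> λ le → enlarge u d Z v v∉ le ρZ≤u n≤ good
      cyclic : Cyclic Z
      cyclic H H⊆Z codim1 = ℕ.≤-antisym (monotone H Z H⊆Z)
        (ℕ.≮⇒≥ λ lt → shrink u Z H H⊆Z codim1 lt ρZ≤u good)

    larger : ∀ Z v → v ∉ Z → dim Z < dim (Z ⊕ ⟨ v ⟩)
    larger Z v v∉ = dim-strict Z (Z ⊕ ⟨ v ⟩) (λ {u} → ⊆⊕ˡ Z ⟨ v ⟩ {u}) {v}
      (⊆⊕ʳ Z ⟨ v ⟩ {v} (v∈⟨v⟩ v)) v∉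

    enlarge u zero Z v v∉ le ρZ≤u n≤ good =
      ℕ.<⇒≱ (larger Z v v∉) (ℕ.≤-trans (dim≤n (Z ⊕ ⟨ v ⟩)) n≤)
    enlarge u (suc d) Z v v∉ le ρZ≤u n≤ good =
      go u d (Z ⊕ ⟨ v ⟩) (ℕ.≤-trans le ρZ≤u) (begin
        n                           ≤⟨ n≤ ⟩
        suc d ℕ.+ dim Z             ≡⟨ ℕ.+-suc d _ ⟨
        d ℕ.+ suc (dim Z)           ≤⟨ ℕ.+-monoʳ-≤ d (larger Z v v∉) ⟩
        d ℕ.+ dim (Z ⊕ ⟨ v ⟩)       ∎) (good-⊕ Z v le good)

    shrink zero    Z H H⊆Z codim1 lt ρZ≤u = contradiction (ℕ.≤-trans lt ρZ≤u) λ ()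
    shrink (suc u) Z H H⊆Z codim1 lt ρZ≤u good =
      go u n H (ℕ.s≤s⁻¹ (ℕ.≤-trans lt ρZ≤u)) (ℕ.m≤m+n n _)
        (good-hyperplane Z H H⊆Z codim1 lt good)

-- Coordinate q-matroids

module CoordinateTransversal {c ℓ q} {F : FiniteField c ℓ q} (Mq : QMatroid F n)
  (coordinate : IsCoordinate Mq) (M : Matroid n) (corresponding : IsCorrespondingMatroid Mq M)
  (𝒜 : Vector (Subset n) k)
  (presents : ∀ X → Matroid.Independent M X ⇔ HasAvoidanceTransversal (≡.setoid (Fin n))
                      (λ i → _∈ˢ 𝒜 i) (_∈ˢ X))
  where
  private
    module M  = Matroid M
    module MP = MatroidProperties M
    module MT = MP.Transversal 𝒜 presents
  open FiniteField F using (0#; _≟_)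
  open LinearAlgebra F
  open LinearAlgebraProperties F
  open QMatroid Mq
  open QMatroidProperties Mq
  open IsCorrespondingMatroid corresponding
  open Subspace

  ρ-φ≤r : ∀ S → ρ (φ S) ≤ M.r S
  ρ-φ≤r S = decidable-stable (ρ (φ S) ℕ.≤? M.r S) λ ≰ → MP.¬¬-cyclicFlat S λ T T-cf good →
    ≰ (ℕ.+-cancelʳ-≤ ∣ S ∩ˢ T ∣ _ _ (begin
      ρ (φ S) ℕ.+ ∣ S ∩ˢ T ∣             ≤⟨ ℕ.+-monoʳ-≤ (ρ (φ S)) (∣∩∣≤dim T) ⟩
      ρ (φ S) ℕ.+ dim (φ S ∩ φ T)        ≤⟨ ρ+dim≤ (φ S) (φ S ∩ φ T) proj₁ ⟩
      ρ (φ S ∩ φ T) ℕ.+ dim (φ S)        ≤⟨ ℕ.+-mono-≤ (monotone (φ S ∩ φ T) (φ T) proj₂) (dim-φ≤ S) ⟩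
      ρ (φ T) ℕ.+ ∣ S ∣                  ≡⟨ ≡.cong (ℕ._+ ∣ S ∣) (ranks T T-cf) ⟨
      M.r T ℕ.+ ∣ S ∣                    ≤⟨ good ⟩
      M.r S ℕ.+ ∣ S ∩ˢ T ∣               ∎))
    where
    open ℕ.≤-Reasoning
    ∣∩∣≤dim : ∀ T → ∣ S ∩ˢ T ∣ ≤ dim (φ S ∩ φ T)
    ∣∩∣≤dim T = independent≤dim (φ S ∩ φ T) (e ∘ elements (S ∩ˢ T))
      (e-independent (elements (S ∩ˢ T)) (elements-injective (S ∩ˢ T)))
      λ i → let ∈S , ∈T = x∈p∩q⁻ S T (elements-∈ (S ∩ˢ T) i) in e∈φ S ∈S , e∈φ T ∈T

  Hall : Subspace n → Set
  Hall X = ∀ S → dim (X ∩ φ S) ≤ ∣ avoidable 𝒜 S ∣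

  independent⇒Hall : ∀ X → Independent X → Hall X
  independent⇒Hall X X-indep S = begin
    dim (X ∩ φ S)          ≡⟨ independent-⊆ X (X ∩ φ S) X-indep proj₁ ⟨
    ρ (X ∩ φ S)            ≤⟨ monotone (X ∩ φ S) (φ S) proj₂ ⟩
    ρ (φ S)                ≤⟨ ρ-φ≤r S ⟩
    M.r S                  ≤⟨ MT.r≤∣avoidable∣ S ⟩
    ∣ avoidable 𝒜 S ∣      ∎
    where open ℕ.≤-Reasoning

  -- Here the walk takes place in `Mq`. The cyclic flat it reaches is some `φ S` with `S` a cyclic
  -- flat of `M`, so its rank is at least |N(S)|.
  ¬¬-avoidable-bound : ∀ X →
    ¬ (∀ S → ¬ ∣ avoidable 𝒜 S ∣ ℕ.+ dim X ≤ ρ X ℕ.+ dim (X ∩ φ S))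
  ¬¬-avoidable-bound X none = ¬¬-cyclicFlat X λ Z Z-cf good →
    case coordinate Z Z-cf of λ (S , Z⊆φS , φS⊆Z) →
    let S-cf = Equivalence.from (cyclicFlats S) (Z , Z-cf , Z⊆φS , φS⊆Z) in
    none S (begin
      ∣ avoidable 𝒜 S ∣ ℕ.+ dim X     ≤⟨ ℕ.+-monoˡ-≤ _ (MT.cyclic⇒∣avoidable∣≤r S (proj₂ S-cf)) ⟩
      M.r S ℕ.+ dim X                 ≡⟨ ≡.cong (ℕ._+ dim X) (ranks S S-cf) ⟩
      ρ (φ S) ℕ.+ dim X               ≤⟨ ℕ.+-monoˡ-≤ _ (monotone (φ S) Z φS⊆Z) ⟩
      ρ Z ℕ.+ dim X                   ≤⟨ good ⟩
      ρ X ℕ.+ dim (X ∩ Z)             ≤⟨ ℕ.+-monoʳ-≤ (ρ X) (dim-mono (X ∩ Z) (X ∩ φ S)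
                                           λ (x∈X , x∈Z) → x∈X , Z⊆φS x∈Z) ⟩
      ρ X ℕ.+ dim (X ∩ φ S)           ∎)
    where open ℕ.≤-Reasoning

  Hall⇒independent : ∀ X → Hall X → Independent X
  Hall⇒independent X hall = ℕ.≤-antisym (bounded X)
    (decidable-stable (dim X ℕ.≤? ρ X) λ ≰ → ¬¬-avoidable-bound X λ S good →
      ≰ (ℕ.+-cancelˡ-≤ ∣ avoidable 𝒜 S ∣ _ _ (begin
        ∣ avoidable 𝒜 S ∣ ℕ.+ dim X     ≤⟨ good ⟩
        ρ X ℕ.+ dim (X ∩ φ S)           ≤⟨ ℕ.+-monoʳ-≤ (ρ X) (hall S) ⟩
        ρ X ℕ.+ ∣ avoidable 𝒜 S ∣       ≡⟨ ℕ.+-comm (ρ X) _ ⟩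
        ∣ avoidable 𝒜 S ∣ ℕ.+ ρ X       ∎)))
    where open ℕ.≤-Reasoning

  module _ (X : Subspace n) where

    -- The definition speaks of all bases, so choose one that prolongs a basis of `X ∩ φ S`. The
    -- indices assigned to those vectors are distinct, and a vector of `φ S` outside `φ (𝒜 i)`
    -- forces `i` into N(S).
    transversal⇒Hall : IsPartialQTransversal (φ ∘ 𝒜) X → Hall X
    transversal⇒Hall X-trans S
      with prolong X {basisOf (X ∩ φ S)} (BasisOf.independent (X ∩ φ S))
             (λ i → proj₁ (BasisOf.contained (X ∩ φ S) i))
    ... | l , b , P , B = injective⇒≤∣∣ (avoidable 𝒜 S) (avoided T ∘ position)
      (λ {i} {j} eq → position-injective {i} {j} (avoided-injective T eq)) λ i →
      ∈-avoidable⁺ 𝒜 S λ S⊆ → avoids (position i) (resp (φ (𝒜 _)) (c≋x i)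
        (φ-mono S⊆ {u i} (proj₂ (BasisOf.contained (X ∩ φ S) i))))
      where
      T = X-trans b B
      open HasAvoidanceTransversal T
      open IsOrdering ordering
      u = basisOf (X ∩ φ S)
      in-image : ∀ i → image b (u i)
      in-image i = case prolongs-index P i of λ (j , eq) →
        j , ≡.subst (u i ≋_) eq ≋-refl
      position : Fin (dim (X ∩ φ S)) → Fin size
      position i = proj₁ (complete (in-image i))
      c≋x : ∀ i → u i ≋ x (position i)
      c≋x i = proj₂ (complete (in-image i))
      position-injective : Injective _≡_ _≡_ position
      position-injective {i} {j} eq = independent⇒distinct u
        (BasisOf.independent (X ∩ φ S)) {i} {j}
        (≋-trans (c≋x i) (≡.subst (λ p → x p ≋ u j) (≡.sym eq) (≋-sym (c≋x j))))

    -- A basis vector avoids `φ (𝒜 i)` exactly when its support is not inside `𝒜 i`, which makes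
    -- this a matching problem. For a minimum cover, let `S` be the union of the supports of the
    -- vectors outside `P`. These vectors lie in `X ∩ φ S` and N(S) lies in `Q`, so the Hall bound
    -- forces every vector to be matched.
    Hall⇒transversal : Hall X → IsPartialQTransversal (φ ∘ 𝒜) X
    Hall⇒transversal hall {d} b B
      with kőnig (λ l → avoidable 𝒜 (support (b l))) ⊤
    ... | I , μ , P , Q , cov , ∣P∣+∣Q∣≤∣I∣ =
      matching⇒transversal (b ∘ elements I)
        (record
          { distinct = λ eq → elements-injective I
              (independent⇒distinct b (IsBasis.independent B) eq)
          ; listed   = λ i → elements I i , ≋-refl
          ; complete = λ {u} (l , u≋) →
              case elements-complete I (≡.subst (l ∈ˢ_) (≡.sym I≡⊤) ∈⊤) of λ (i , eq) →
              i , ≡.subst (λ l → u ≋ b l) eq u≋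
          })
        (partner μ) (partner-injective μ)
        (λ i b∈ → ∈-avoidable⁻ 𝒜 (support (b (elements I i))) (partner-adjacent μ i)
          (∈φ⇒support⊆ (b (elements I i)) (𝒜 (partner μ i)) b∈))
      where
      open ℕ.≤-Reasoning
      hit? : ∀ j → Dec (∃ λ l → l ∉ˢ P × j ∈ˢ support (b l))
      hit? j = any? λ l → ¬? (l ∈ˢ? P) ×-dec (j ∈ˢ? support (b l))
      S = select hit?
      S-avoidable⊆Q : avoidable 𝒜 S ⊆ˢ Q
      S-avoidable⊆Q {i} i∈ = decidable-stable (i ∈ˢ? Q) λ i∉Q → ∈-avoidable⁻ 𝒜 S i∈ λ {j} j∈ →
        decidable-stable (j ∈ˢ? 𝒜 i) λ j∉A → case ∈-select⁻ hit? j∈ of λ (l , l∉P , j∈l) →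
        case cov ∈⊤ (∈-avoidable⁺ 𝒜 (support (b l)) λ ⊆A → j∉A (⊆A j∈l)) of λ where
          (inj₁ l∈P) → l∉P l∈P
          (inj₂ i∈Q) → i∉Q i∈Q
      d≤∣I∣ : d ≤ ∣ I ∣
      d≤∣I∣ = begin
        d                           ≡⟨ ℕ.m+[n∸m]≡n (∣p∣≤n P) ⟨
        ∣ P ∣ ℕ.+ (d ℕ.∸ ∣ P ∣)     ≡⟨ ≡.cong (∣ P ∣ ℕ.+_) (∣∁p∣≡n∸∣p∣ P) ⟨
        ∣ P ∣ ℕ.+ ∣ ∁ P ∣           ≤⟨ ℕ.+-monoʳ-≤ ∣ P ∣ (independent≤dim (X ∩ φ S) (b ∘ elements (∁ P))
          (independent-∘ b (IsBasis.independent B) (elements (∁ P)) (elements-injective (∁ P)))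
          λ i → IsBasis.contained B (elements (∁ P) i) ,
            support⊆⇒∈φ (b (elements (∁ P) i)) S λ j∈ →
              ∈-select⁺ hit? (elements (∁ P) i , x∈∁p⇒x∉p (elements-∈ (∁ P) i) , j∈)) ⟩
        ∣ P ∣ ℕ.+ dim (X ∩ φ S)     ≤⟨ ℕ.+-monoʳ-≤ ∣ P ∣ (hall S) ⟩
        ∣ P ∣ ℕ.+ ∣ avoidable 𝒜 S ∣ ≤⟨ ℕ.+-monoʳ-≤ ∣ P ∣ (p⊆q⇒∣p∣≤∣q∣ S-avoidable⊆Q) ⟩
        ∣ P ∣ ℕ.+ ∣ Q ∣             ≤⟨ ∣P∣+∣Q∣≤∣I∣ ⟩
        ∣ I ∣                       ∎
      I≡⊤ : I ≡ ⊤
      I≡⊤ = ∣p∣≡n⇒p≡⊤ (ℕ.≤-antisym (∣p∣≤n I) d≤∣I∣)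

  isQTransversal : IsQTransversal Mq
  isQTransversal = k , φ ∘ 𝒜 , λ X → mk⇔
    (λ X-indep {d} → Hall⇒transversal X (independent⇒Hall X X-indep) {d})
    (λ X-trans → Hall⇒independent X (transversal⇒Hall X λ {d} → X-trans {d}))

-- Quadratic extensions

module Quadratic {c ℓ q} (F : FiniteField c ℓ q) where
  open FiniteField F hiding (zero)
  open import Algebra.Properties.AbelianGroup +-abelianGroup using () renaming (∙-cancelˡ to +-cancelˡ)
  open import Algebra.Solver.Ring.NaturalCoefficients.Default commutativeSemiring
  open import Relation.Binary.Reasoning.Setoid setoid

  private
    module E = Inverse enumeration

  no-zero-divisors : ∀ x y → x ≉ 0# → x * y ≈ 0# → y ≈ 0#
  no-zero-divisors x y x≉0 xy≈0 with inverse x x≉0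
  ... | w , xw≈1 = begin
    y             ≈⟨ *-identityˡ y ⟨
    1# * y        ≈⟨ *-congʳ xw≈1 ⟨
    (x * w) * y   ≈⟨ solve 3 (λ x w y → (x :* w) :* y := w :* (x :* y)) refl x w y ⟩
    w * (x * y)   ≈⟨ *-congˡ xy≈0 ⟩
    w * 0#        ≈⟨ zeroʳ w ⟩
    0#            ∎

  -- The map y ↦ y² - y takes the value 0 at both 0 and 1, so it is not
  -- injective, hence not surjective.
  rootless : ∃ λ r → ∀ y → y * y ≉ y + r
  rootless with any? (λ i → Fin.all? λ j →
                  ¬? (E.from j * E.from j ≟ E.from j + E.from i))
  ... | yes (i , no-root) = E.from i , λ y eq → no-root (E.to y) (begin
    E.from (E.to y) * E.from (E.to y)  ≈⟨ *-cong (E.strictlyInverseʳ y) (E.strictlyInverseʳ y) ⟩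
    y * y                              ≈⟨ eq ⟩
    y + E.from i                       ≈⟨ +-congʳ (E.strictlyInverseʳ y) ⟨
    E.from (E.to y) + E.from i         ∎)
  ... | no all-rooted = contradiction (injective⇒≤ f-injective) (ℕ.<⇒≱ (ℕ.n<1+n q))
    where
    root : ∀ i → ∃ λ y → y * y ≈ y + E.from i × y ≉ 0#
    root i with any? (λ j → E.from j * E.from j ≟ E.from j + E.from i)
    ... | no none = contradiction (i , λ j eq → none (j , eq)) all-rooted
    ... | yes (j , eq) with E.from j ≟ 0#
    ...   | no  y≉0 = E.from j , eq , y≉0
    -- The root 0 makes `E.from i` vanish, so 1 is a root too. Nonzero roots leave 0 free for
    -- `f zero`, which gives one element too many.
    ...   | yes y≈0 = 1# , (begin
      1# * 1#                 ≈⟨ *-identityˡ 1# ⟩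
      1#                      ≈⟨ +-identityʳ 1# ⟨
      1# + 0#                 ≈⟨ +-congˡ (zeroˡ (E.from j)) ⟨
      1# + 0# * E.from j      ≈⟨ +-congˡ (*-congʳ y≈0) ⟨
      1# + E.from j * E.from j  ≈⟨ +-congˡ eq ⟩
      1# + (E.from j + E.from i) ≈⟨ +-congˡ (+-congʳ y≈0) ⟩
      1# + (0# + E.from i)    ≈⟨ +-congˡ (+-identityˡ _) ⟩
      1# + E.from i           ∎) , λ 1≈0 → 0≉1 (sym 1≈0)

    to-injective = Injection.injective (Inverse⇒Injection enumeration)

    f : Fin (suc q) → Fin q
    f zero    = E.to 0#
    f (suc i) = E.to (proj₁ (root i))

    f-injective : Injective _≡_ _≡_ f
    f-injective {zero}  {zero}  _  = ≡.refl
    f-injective {zero}  {suc j} eq =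
      contradiction (sym (to-injective eq)) (proj₂ (proj₂ (root j)))
    f-injective {suc i} {zero}  eq =
      contradiction (to-injective eq) (proj₂ (proj₂ (root i)))
    f-injective {suc i} {suc j} eq = ≡.cong suc (≡.trans (≡.sym (E.strictlyInverseˡ i))
      (≡.trans (E.to-cong same) (E.strictlyInverseˡ j)))
      where
      y = proj₁ (root i)
      z = proj₁ (root j)
      same : E.from i ≈ E.from j
      same = +-cancelˡ y _ _ (begin
        y + E.from i  ≈⟨ proj₁ (proj₂ (root i)) ⟨
        y * y         ≈⟨ *-cong (to-injective eq) (to-injective eq) ⟩
        z * z         ≈⟨ proj₁ (proj₂ (root j)) ⟩
        z + E.from j  ≈⟨ +-congʳ (to-injective eq) ⟨
        y + E.from j  ∎)

  r : Carrier
  r = proj₁ rootless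

  additive : AbelianGroup c ℓ
  additive = DirectProduct.abelianGroup +-abelianGroup +-abelianGroup

  module P = AbelianGroup additive

  -- The pair (a , b) stands for a + b α, where α² = α + r.
  infixl 7 _⊗_
  _⊗_ : P.Carrier → P.Carrier → P.Carrier
  (x , y) ⊗ (z , w) = x * z + r * (y * w) , (x * w + y * z) + y * w

  extensionRing : CommutativeRing c ℓ
  extensionRing = record
    { _*_ = _⊗_
    ; 1#  = 1# , 0#
    ; isCommutativeRing = record
      { isRing = record
        { +-isAbelianGroup = P.isAbelianGroup
        ; *-cong = λ (x , y) (z , w) →
            +-cong (*-cong x z) (*-congˡ (*-cong y w)) ,
            +-cong (+-cong (*-cong x w) (*-cong y z)) (*-cong y w)
        ; *-assoc = λ (x , y) (z , w) (u , v) →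
            solve 7 (λ r x y z w u v →
              (x :* z :+ r :* (y :* w)) :* u :+ r :* ((x :* w :+ y :* z :+ y :* w) :* v) :=
              x :* (z :* u :+ r :* (w :* v)) :+ r :* (y :* (z :* v :+ w :* u :+ w :* v)))
              refl r x y z w u v ,
            solve 7 (λ r x y z w u v →
              (x :* z :+ r :* (y :* w)) :* v :+ (x :* w :+ y :* z :+ y :* w) :* u
                :+ (x :* w :+ y :* z :+ y :* w) :* v :=
              x :* (z :* v :+ w :* u :+ w :* v) :+ y :* (z :* u :+ r :* (w :* v))
                :+ y :* (z :* v :+ w :* u :+ w :* v))
              refl r x y z w u v
        ; *-identity =
            (λ (x , y) →
              solve 3 (λ r x y → con 1 :* x :+ r :* (con 0 :* y) := x) refl r x y ,
              solve 2 (λ x y → con 1 :* y :+ con 0 :* x :+ con 0 :* y := y) refl x y) ,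
            (λ (x , y) →
              solve 3 (λ r x y → x :* con 1 :+ r :* (y :* con 0) := x) refl r x y ,
              solve 2 (λ x y → x :* con 0 :+ y :* con 1 :+ y :* con 0 := y) refl x y)
        ; distrib =
            (λ (x , y) (z , w) (u , v) →
              solve 7 (λ r x y z w u v → x :* (z :+ u) :+ r :* (y :* (w :+ v)) :=
                (x :* z :+ r :* (y :* w)) :+ (x :* u :+ r :* (y :* v))) refl r x y z w u v ,
              solve 6 (λ x y z w u v → x :* (w :+ v) :+ y :* (z :+ u) :+ y :* (w :+ v) :=
                (x :* w :+ y :* z :+ y :* w) :+ (x :* v :+ y :* u :+ y :* v))
                refl x y z w u v) ,
            (λ (x , y) (z , w) (u , v) →
              solve 7 (λ r x y z w u v → (z :+ u) :* x :+ r :* ((w :+ v) :* y) :=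
                (z :* x :+ r :* (w :* y)) :+ (u :* x :+ r :* (v :* y))) refl r x y z w u v ,
              solve 6 (λ x y z w u v → (z :+ u) :* y :+ (w :+ v) :* x :+ (w :+ v) :* y :=
                (z :* y :+ w :* x :+ w :* y) :+ (u :* y :+ v :* x :+ v :* y))
                refl x y z w u v)
        }
      ; *-comm = λ (x , y) (z , w) →
          solve 5 (λ r x y z w → x :* z :+ r :* (y :* w) := z :* x :+ r :* (w :* y))
            refl r x y z w ,
          solve 4 (λ x y z w → x :* w :+ y :* z :+ y :* w := z :* y :+ w :* x :+ w :* y)
            refl x y z w
      }
    }

  -- The norm of a + b α, whose conjugate is (a + b) - b α.
  norm : Carrier → Carrier → Carrier
  norm x y = x * (x + y) + r * (y * (- y))

  -- Division by y² turns a zero of the norm with y ≠ 0 into the root t = -x/y of t² = t + r, which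
  -- `rootless` excludes.
  norm≉0 : ∀ x y → ¬ (x ≈ 0# × y ≈ 0#) → norm x y ≉ 0#
  norm≉0 x y xy≉0 norm≈0 with y ≟ 0#
  ... | yes y≈0 = xy≉0 (x≈0 , y≈0)
    where
    x*x≈0 : x * x ≈ 0#
    x*x≈0 = begin
      x * x                              ≈⟨ solve 3 (λ r x n → x :* x := x :* (x :+ con 0) :+ r :* (con 0 :* n))
                                              refl r x (- y) ⟩
      x * (x + 0#) + r * (0# * (- y))    ≈⟨ +-cong (*-congˡ (+-congˡ y≈0)) (*-congˡ (*-congʳ y≈0)) ⟨
      norm x y                           ≈⟨ norm≈0 ⟩
      0#                                 ∎
    x≈0 : x ≈ 0#
    x≈0 with x ≟ 0#
    ... | yes x≈0 = x≈0
    ... | no  x≉0 = no-zero-divisors x x x≉0 x*x≈0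
  ... | no y≉0 with inverse y y≉0
  ...   | v , yv≈1 = proj₂ rootless t (begin
    t * t                                        ≈⟨ +-identityʳ _ ⟨
    t * t + 0#                                   ≈⟨ +-congˡ μ*≈0 ⟨
    -- The added term is zero because `1# + μ` is; with `μ` as a variable the rearrangement is a
    -- semiring identity.
    t * t + (t + r) * (1# + μ)                   ≈⟨ solve 4 (λ t μ r y → t :* t :+ (t :+ r) :* (con 1 :+ μ) :=
                                                      (t :* t :+ t :* μ :+ r :* μ) :+ (t :+ r)) refl t μ r y ⟩
    (t * t + t * μ + r * μ) + (t + r)            ≈⟨ +-congʳ vanishing ⟩
    0# + (t + r)                                 ≈⟨ +-identityˡ _ ⟩
    t + r                                        ∎)
    where
    n′ = - y
    -- w = - v is the inverse of n′ = - y, t = - x / y and μ = - 1.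
    w = - v
    t = x * w
    μ = y * w
    1+μ≈0 : 1# + μ ≈ 0#
    1+μ≈0 = begin
      1# + y * w      ≈⟨ +-congʳ yv≈1 ⟨
      y * v + y * w   ≈⟨ distribˡ y v w ⟨
      y * (v + w)     ≈⟨ *-congˡ (-‿inverseʳ v) ⟩
      y * 0#          ≈⟨ zeroʳ y ⟩
      0#              ∎
    μ*≈0 : (t + r) * (1# + μ) ≈ 0#
    μ*≈0 = trans (*-congˡ 1+μ≈0) (zeroʳ _)
    n′w≈1 : n′ * w ≈ 1#
    n′w≈1 = begin
      n′ * w                     ≈⟨ +-identityʳ _ ⟨
      n′ * w + 0#                ≈⟨ +-congˡ 1+μ≈0 ⟨
      n′ * w + (1# + y * w)      ≈⟨ solve 3 (λ n y w → n :* w :+ (con 1 :+ y :* w) := con 1 :+ (y :+ n) :* w)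
                                      refl n′ y w ⟩
      1# + (y + n′) * w          ≈⟨ +-congˡ (*-congʳ (-‿inverseʳ y)) ⟩
      1# + 0# * w                ≈⟨ +-congˡ (zeroˡ w) ⟩
      1# + 0#                    ≈⟨ +-identityʳ 1# ⟩
      1#                         ∎
    vanishing : t * t + t * μ + r * μ ≈ 0#
    vanishing = begin
      t * t + t * μ + r * μ            ≈⟨ +-congˡ (*-identityʳ _) ⟨
      t * t + t * μ + r * μ * 1#       ≈⟨ +-congˡ (*-congˡ n′w≈1) ⟨
      t * t + t * μ + r * μ * (n′ * w) ≈⟨ solve 5 (λ x y w r n →
          x :* w :* (x :* w) :+ x :* w :* (y :* w) :+ r :* (y :* w) :* (n :* w) :=
          (x :* (x :+ y) :+ r :* (y :* n)) :* (w :* w)) refl x y w r n′ ⟩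
      norm x y * (w * w)               ≈⟨ *-congʳ norm≈0 ⟩
      0# * (w * w)                     ≈⟨ zeroˡ _ ⟩
      0#                               ∎

  extensionField : FiniteField c ℓ (q ℕ.* q)
  extensionField = record
    { commutativeRing = extensionRing
    ; 0≉1 = 0≉1 ∘ proj₁
    ; inverse = λ (x , y) xy≉0 →
        let w , nw≈1 = inverse (norm x y) (norm≉0 x y xy≉0)
        in (w * (x + y) , w * (- y)) , (begin
             x * (w * (x + y)) + r * (y * (w * (- y)))
               ≈⟨ solve 5 (λ r x y n w → x :* (w :* (x :+ y)) :+ r :* (y :* (w :* n)) :=
                    (x :* (x :+ y) :+ r :* (y :* n)) :* w) refl r x y (- y) w ⟩
             norm x y * w
               ≈⟨ nw≈1 ⟩
             1#
               ∎) , (begin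
             (x * (w * (- y)) + y * (w * (x + y))) + y * (w * (- y))
               ≈⟨ solve 4 (λ x y n w → x :* (w :* n) :+ y :* (w :* (x :+ y)) :+ y :* (w :* n) :=
                    w :* ((x :+ y) :* (y :+ n))) refl x y (- y) w ⟩
             w * ((x + y) * (y + - y))
               ≈⟨ *-congˡ (trans (*-congˡ (-‿inverseʳ y)) (zeroʳ _)) ⟩
             w * 0#
               ≈⟨ zeroʳ w ⟩
             0#
               ∎)
    ; enumeration = record
      { to        = λ (x , y) → pair (E.to x) (E.to y)
      ; from      = λ i → E.from (proj₁ (remQuot {q} q i)) , E.from (proj₂ (remQuot {q} q i))
      ; to-cong   = λ (x , y) → ≡.cong₂ pair (E.to-cong x) (E.to-cong y)
      ; from-cong = λ { ≡.refl → refl , refl }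
      ; inverse   =
          (λ {i} (x , y) → ≡.trans
            (≡.cong₂ pair (E.inverseˡ x) (E.inverseˡ y)) (combine-remQuot {q} q i)) ,
          λ { {x , y} ≡.refl →
            E.inverseʳ (≡.cong proj₁ (remQuot-combine (E.to x) (E.to y))) ,
            E.inverseʳ (≡.cong proj₂ (remQuot-combine (E.to x) (E.to y))) }
      }
    }

-- Extensions with coordinates

dot : (F : FiniteField c ℓ q) → let open FiniteField F; open LinearAlgebra F in
      V n → V n → Carrier
dot F u v = sum λ j → u j * v j
  where
  open FiniteField F
  open import Algebra.Properties.CommutativeMonoid.Sum +-commutativeMonoid using (sum)

-- The functions π are the coordinates with respect to a basis of L over K;
-- span-lift expresses that this basis generates L.
record Coordinates {p p′} (K : FiniteField c ℓ p) (L : FiniteField c ℓ p′)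
  : Set (c ⊔ ℓ) where
  private
    module K  = FiniteField K
    module L  = FiniteField L
    module KV = LinearAlgebra K
    module LV = LinearAlgebra L
  field
    extension : Extension K L
  open Extension extension public
  open RingMorphisms.IsRingHomomorphism isRingHomomorphism public
  field
    degree    : ℕ
    size      : p′ ≡ p ^ degree
    π         : Fin degree → L.Carrier → K.Carrier
    π-cong    : ∀ s {x y} → x L.≈ y → π s x K.≈ π s y
    π-+       : ∀ s x y → π s (x L.+ y) K.≈ π s x K.+ π s y
    π-*       : ∀ s x a → π s (x L.* ι a) K.≈ π s x K.* a
    span-lift : ∀ {n k} (b : Vector (KV.V n) k) {u : LV.V n} →
                (∀ s → (π s ∘ u) KV.∈ KV.span b) → u LV.∈ LV.span (λ i j → ι (b i j))

  private
    module KP = LinearAlgebraProperties K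
  open import Algebra.Properties.CommutativeMonoid.Sum K.+-commutativeMonoid
    using () renaming (sum to sumᴷ; sum-cong-≋ to sumᴷ-cong)
  open import Algebra.Properties.CommutativeMonoid.Sum L.+-commutativeMonoid
    using () renaming (sum to sumᴸ; sum-cong-≋ to sumᴸ-cong)

  π-0 : ∀ s → π s L.0# K.≈ K.0#
  π-0 s = begin
    π s L.0#                    ≈⟨ π-cong s (L.zeroˡ (ι K.0#)) ⟨
    π s (L.0# L.* ι K.0#)       ≈⟨ π-* s L.0# K.0# ⟩
    π s L.0# K.* K.0#           ≈⟨ K.zeroʳ _ ⟩
    K.0#                        ∎
    where open import Relation.Binary.Reasoning.Setoid K.setoid

  π-sum : ∀ s (x : Vector L.Carrier k) → π s (sumᴸ x) K.≈ sumᴷ (π s ∘ x)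
  π-sum {zero}  s x = π-0 s
  π-sum {suc k} s x = K.trans (π-+ s (x zero) _) (K.+-congˡ (π-sum s (x ∘ suc)))

  π-dot : ∀ s (u : LV.V n) (g : KV.V n) → π s (dot L u (ι ∘ g)) K.≈ dot K (π s ∘ u) g
  π-dot s u g = K.trans (π-sum s (λ j → u j L.* ι (g j))) (sumᴷ-cong λ j → π-* s (u j) (g j))

  ι-sum : (x : Vector K.Carrier k) → ι (sumᴷ x) L.≈ sumᴸ (ι ∘ x)
  ι-sum {zero}  x = 0#-homo
  ι-sum {suc k} x = L.trans (+-homo (x zero) _) (L.+-congˡ (ι-sum (x ∘ suc)))

  ι-dot : (u v : KV.V n) → ι (dot K u v) L.≈ dot L (ι ∘ u) (ι ∘ v)
  ι-dot u v = L.trans (ι-sum (λ j → u j K.* v j)) (sumᴸ-cong λ j → *-homo (u j) (v j))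

  π-combine : ∀ s (t : LV.V k) (b : Vector (KV.V n) k) → ∀ j →
    π s (LV.combine t (λ i j → ι (b i j)) j) K.≈ KV.combine (π s ∘ t) b j
  π-combine s t b j = K.trans (π-sum s (λ i → t i L.* ι (b i j)))
    (sumᴷ-cong λ i → π-* s (t i) (b i j))

  ι-combine : (s : KV.V k) (b : Vector (KV.V n) k) → ∀ j →
    ι (KV.combine s b j) L.≈ LV.combine (ι ∘ s) (λ i j → ι (b i j)) j
  ι-combine s b j = L.trans (ι-sum (λ i → s i K.* b i j)) (sumᴸ-cong λ i → *-homo (s i) (b i j))

  span-lower : (U : KV.Subspace n) (b : Vector (KV.V n) k) → (∀ i → b i KV.∈ U) →
               ∀ {u} → u LV.∈ LV.span (λ i j → ι (b i j)) → ∀ s → (π s ∘ u) KV.∈ U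
  span-lower U b b∈ {u} (t , u≋) s = KP.span-least U b b∈
    (π s ∘ t , λ j → K.trans (π-cong s (u≋ j)) (π-combine s t b j))

  -- `span-lift` for the empty family, whose span is zero over either field.
  π-injective : {u : LV.V n} → (∀ s → (π s ∘ u) KV.≋ KV.0ᵥ) → u LV.≋ LV.0ᵥ
  π-injective πu≈0 = proj₂ (span-lift []ᵥ λ s → []ᵥ , πu≈0 s)

  ι-nonzero : ∀ {a} → a K.≉ K.0# → ι a L.≉ L.0#
  ι-nonzero {a} a≉0 ιa≈0 with K.inverse a a≉0
  ... | w , aw≈1 = L.0≉1 (begin
    L.0#               ≈⟨ L.zeroˡ (ι w) ⟨
    L.0# L.* ι w       ≈⟨ L.*-congʳ ιa≈0 ⟨
    ι a L.* ι w        ≈⟨ *-homo a w ⟨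
    ι (a K.* w)        ≈⟨ ⟦⟧-cong aw≈1 ⟩
    ι K.1#             ≈⟨ 1#-homo ⟩
    L.1#               ∎)
    where open import Relation.Binary.Reasoning.Setoid L.setoid

  ι-injective : ∀ {a} → ι a L.≈ L.0# → a K.≈ K.0#
  ι-injective {a} ιa≈0 = decidable-stable (a K.≟ K.0#) λ a≉0 → ι-nonzero a≉0 ιa≈0

  -- Degree 0 would leave `L` with a single element.
  1≤degree : 1 ≤ degree
  1≤degree with degree | size
  ... | zero  | eq = contradiction (≡.subst (1 <_) eq LV.1<q) (ℕ.<-irrefl ≡.refl)
  ... | suc _ | _  = s≤s z≤n

identityCoordinates : (K : FiniteField c ℓ p) → Coordinates K K
identityCoordinates {p = p} K = record
  { extension = record
    { ι = λ x → x
    ; isRingHomomorphism = Identity.isRingHomomorphism rawRing refl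
    }
  ; degree    = 1
  ; size      = ≡.sym (ℕ.*-identityʳ p)
  ; π         = λ _ x → x
  ; π-cong    = λ _ eq → eq
  ; π-+       = λ _ _ _ → refl
  ; π-*       = λ _ _ _ → refl
  ; span-lift = λ b πu∈ → πu∈ zero
  }
  where open FiniteField K hiding (zero)

quadraticCoordinates : (K : FiniteField c ℓ p) → Coordinates K (Quadratic.extensionField K)
quadraticCoordinates {p = p} K = record
  { extension = record
    { ι = λ x → x , 0#
    ; isRingHomomorphism = record
      { isSemiringHomomorphism = record
        { isNearSemiringHomomorphism = record
          { +-isMonoidHomomorphism = record
            { isMagmaHomomorphism = record
              { isRelHomomorphism = record { cong = λ eq → eq , refl }
              ; homo = λ x y → refl , sym (+-identityʳ 0#)
              }
            ; ε-homo = refl , refl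
            }
          ; *-homo = λ x y →
              solve 3 (λ r x y → x :* y := x :* y :+ r :* (con 0 :* con 0)) refl r x y ,
              solve 2 (λ x y → con 0 := x :* con 0 :+ con 0 :* y :+ con 0 :* con 0) refl x y
          }
        ; 1#-homo = refl , refl
        }
      ; -‿homo = λ x → refl , sym -0#≈0#
      }
    }
  ; degree    = 2
  ; size      = ≡.cong (p ℕ.*_) (≡.sym (ℕ.*-identityʳ p))
  ; π         = λ where
      zero    (x , y) → x
      (suc _) (x , y) → y
  ; π-cong    = λ where
      zero    (x , y) → x
      (suc _) (x , y) → y
  ; π-+       = λ where
      zero    _ _ → refl
      (suc _) _ _ → refl
  ; π-*       = λ where
      zero (x , y) a →
        solve 4 (λ r x y a → x :* a :+ r :* (y :* con 0) := x :* a) refl r x y a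
      (suc _) (x , y) a →
        solve 3 (λ x y a → x :* con 0 :+ y :* a :+ y :* con 0 := y :* a) refl x y a
  ; span-lift = λ b {u} πu∈ →
      let s , eq = πu∈ zero
          t , eq′ = πu∈ (suc zero)
      in (λ i → s i , t i) , λ j → trans (eq j) (first s t b j) , trans (eq′ j) (second s t b j)
  }
  where
  open FiniteField K hiding (zero)
  open Quadratic K using (r; extensionField)
  open LinearAlgebra K using (V; combine)
  module L = LinearAlgebra extensionField
  open import Algebra.Properties.Ring ring using (-0#≈0#)
  open import Algebra.Solver.Ring.NaturalCoefficients.Default commutativeSemiring

  first : (s t : V k) (b : Vector (V n) k) → ∀ j →
          combine s b j ≈ proj₁ (L.combine (λ i → s i , t i) (λ i j → b i j , 0#) j)
  first {zero}  s t b j = refl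
  first {suc k} s t b j = +-cong
    (solve 4 (λ r s t b → s :* b := s :* b :+ r :* (t :* con 0)) refl
      r (s zero) (t zero) (b zero j))
    (first (s ∘ suc) (t ∘ suc) (b ∘ suc) j)

  second : (s t : V k) (b : Vector (V n) k) → ∀ j →
           combine t b j ≈ proj₂ (L.combine (λ i → s i , t i) (λ i j → b i j , 0#) j)
  second {zero}  s t b j = refl
  second {suc k} s t b j = +-cong
    (solve 3 (λ s t b → t :* b := s :* con 0 :+ t :* b :+ t :* con 0) refl
      (s zero) (t zero) (b zero j))
    (second (s ∘ suc) (t ∘ suc) (b ∘ suc) j)

module _ {p p′ p″} {K : FiniteField c ℓ p} {L : FiniteField c ℓ p′} {N : FiniteField c ℓ p″}
  (E : Coordinates K L) (E′ : Coordinates L N) where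
  private
    module K  = FiniteField K
    module N  = FiniteField N
    module KV = LinearAlgebra K
    module E  = Coordinates E
    module E′ = Coordinates E′

    inner : Fin (E.degree ℕ.* E′.degree) → Fin E.degree
    inner s = proj₁ (remQuot {E.degree} E′.degree s)
    outer : Fin (E.degree ℕ.* E′.degree) → Fin E′.degree
    outer s = proj₂ (remQuot {E.degree} E′.degree s)

  composeCoordinates : Coordinates K N
  composeCoordinates = record
    { extension = record
      { ι = E′.ι ∘ E.ι
      ; isRingHomomorphism =
          Composition.isRingHomomorphism N.trans E.isRingHomomorphism E′.isRingHomomorphism
      }
    ; degree    = E.degree ℕ.* E′.degree
    ; size      = ≡.trans E′.size (≡.trans (≡.cong (_^ E′.degree) E.size)
                    (ℕ.^-*-assoc p E.degree E′.degree))
    ; π         = λ s → E.π (inner s) ∘ E′.π (outer s)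
    ; π-cong    = λ s eq → E.π-cong (inner s) (E′.π-cong (outer s) eq)
    ; π-+       = λ s x y →
        K.trans (E.π-cong (inner s) (E′.π-+ (outer s) x y)) (E.π-+ (inner s) _ _)
    ; π-*       = λ s x a →
        K.trans (E.π-cong (inner s) (E′.π-* (outer s) x (E.ι a))) (E.π-* (inner s) _ a)
    ; span-lift = λ b {u} πu∈ → E′.span-lift (λ i j → E.ι (b i j)) λ t → E.span-lift b λ s →
        ≡.subst (λ (s , t) → (E.π s ∘ E′.π t ∘ u) KV.∈ KV.span b) (remQuot-combine s t)
          (πu∈ (pair s t))
    }

  π-pair : ∀ s t x → Coordinates.π composeCoordinates (pair s t) x ≡ E.π s (E′.π t x)
  π-pair s t x = ≡.cong (λ (s , t) → E.π s (E′.π t x)) (remQuot-combine s t)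

-- Each entry of the vector is taken in a fresh quadratic extension.
genericVector : ∀ n (K : FiniteField c ℓ p) →
  ∃ λ p′ → Σ[ L ∈ FiniteField c ℓ p′ ] Σ[ E ∈ Coordinates K L ]
  Σ[ t ∈ LinearAlgebra.V L n ]
  ∀ u → FiniteField._≈_ L (dot L (Coordinates.ι E ∘ u) t) (FiniteField.0# L) →
  LinearAlgebra._≋_ K u (LinearAlgebra.0ᵥ K)
genericVector zero    K = _ , K , identityCoordinates K , []ᵥ , λ u _ ()
genericVector (suc n) K with genericVector n K
... | p′ , L , E , t , t-indep =
  _ , Quadratic.extensionField L , composeCoordinates E E′ , (0# , 1#) ∷ᵥ E′.ι ∘ t , indep
  where
  open FiniteField L hiding (zero)
  module K = FiniteField K
  module N = FiniteField (Quadratic.extensionField L)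
  E′ = quadraticCoordinates L
  module E  = Coordinates E
  module E′ = Coordinates E′
  open Quadratic L using (r)
  open import Relation.Binary.Reasoning.Setoid setoid
  open import Algebra.Solver.Ring.NaturalCoefficients.Default commutativeSemiring

  module _ (u : LinearAlgebra.V K (suc n))
    (eq : dot (Quadratic.extensionField L) (E′.ι ∘ E.ι ∘ u) ((0# , 1#) ∷ᵥ E′.ι ∘ t) N.≈ N.0#)
    where
    u₀   = E.ι (u zero)
    rest = dot L (E.ι ∘ u ∘ suc) t

    -- With α = `(0# , 1#)` the product is `rest` + `u₀` α, where `rest` and `u₀` lie in `L`; its
    -- two coordinates vanish separately.
    eq′ : (u₀ * 0# + r * (0# * 1#)) + rest ≈ 0# × ((u₀ * 1# + 0# * 0#) + 0# * 1#) + 0# ≈ 0#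
    eq′ = N.trans (N.+-congˡ {u₀ * 0# + r * (0# * 1#) , (u₀ * 1# + 0# * 0#) + 0# * 1#}
      (E′.ι-dot (E.ι ∘ u ∘ suc) t)) eq

    indep : ∀ j → u j K.≈ K.0#
    indep zero    = E.ι-injective (begin
      u₀                                         ≈⟨ solve 1 (λ x → x := ((x :* con 1 :+ con 0 :* con 0)
                                                      :+ con 0 :* con 1) :+ con 0) refl u₀ ⟩
      ((u₀ * 1# + 0# * 0#) + 0# * 1#) + 0#       ≈⟨ proj₂ eq′ ⟩
      0#                                         ∎)
    indep (suc j) = t-indep (u ∘ suc) (begin
      rest                                       ≈⟨ solve 3 (λ x r y → y := (x :* con 0 :+
                                                      r :* (con 0 :* con 1)) :+ y) refl u₀ r rest ⟩
      (u₀ * 0# + r * (0# * 1#)) + rest           ≈⟨ proj₁ eq′ ⟩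
      0#                                         ∎) j

-- Generic matrices with prescribed zeros

module Hyperplane {p p′} {K : FiniteField c ℓ p} {L : FiniteField c ℓ p′}
  (E : Coordinates K L) (A : Subset n) (t : LinearAlgebra.V L n)
  (t-indep : ∀ u → FiniteField._≈_ L (dot L (Coordinates.ι E ∘ u) t) (FiniteField.0# L) →
             LinearAlgebra._≋_ K u (LinearAlgebra.0ᵥ K))
  where
  private
    module K  = FiniteField K
    module KV where
      open LinearAlgebra K public
      open LinearAlgebraProperties K public
  open FiniteField L hiding (zero)
  open LinearAlgebra L
  open LinearAlgebraProperties L
  open Coordinates E
  open import Algebra.Properties.CommutativeMonoid.Sum +-commutativeMonoid
    using (sum-cong-≋)

  g : V n
  g j with j ∈ˢ? A
  ... | yes _ = 0#
  ... | no  _ = t j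

  g-vanishes : ∀ {j} → j ∈ˢ A → g j ≈ 0#
  g-vanishes {j} j∈ with j ∈ˢ? A
  ... | yes _  = refl
  ... | no  j∉ = contradiction j∈ j∉

  -- Off `A` the functional `g` agrees with `t`, so its vanishing on a vector over `K` is a
  -- `K`-linear relation among entries of `t`.
  dot-g≈0⇒∈φ : (v : KV.V n) → dot L (ι ∘ v) g ≈ 0# → v KV.∈ KV.φ A
  dot-g≈0⇒∈φ v eq = KV.∈φ⁺ A {v} λ {j} j∉ → K.trans (K.sym (off-A j∉))
    (t-indep restricted (trans (sum-cong-≋ agree) eq) j)
    where
    restricted : KV.V n
    restricted j with j ∈ˢ? A
    ... | yes _ = K.0#
    ... | no  _ = v j
    off-A : ∀ {j} → j ∉ˢ A → restricted j K.≈ v j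
    off-A {j} j∉ with j ∈ˢ? A
    ... | yes j∈ = contradiction j∈ j∉
    ... | no  _  = K.refl
    agree : ∀ j → ι (restricted j) * t j ≈ ι (v j) * g j
    agree j with j ∈ˢ? A
    ... | yes _ = trans (trans (*-congʳ 0#-homo) (zeroˡ (t j))) (sym (zeroʳ (ι (v j))))
    ... | no  _ = refl

  -- The part of U ⊗ L on which the functional g vanishes.
  cut : KV.Subspace n → Subspace n
  cut U = span (λ i → ι ∘ KV.basisOf U i) ∩ annihilator g

  ∈cut⁺ : ∀ U {v} → (∀ s → (π s ∘ v) KV.∈ U) → dot L v g ≈ 0# → v ∈ cut U
  ∈cut⁺ U {v} πv∈ v⊥g =
    span-lift (KV.basisOf U) (λ s → KV.BasisOf.spanning U (πv∈ s)) , lift v⊥g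

  module _ (U : KV.Subspace n) (S : Subset n) where
    private
      W = U KV.∩ KV.φ S
      bᵂ = KV.basisOf W
      X = cut U ∩ φ S

    cut⊆span : X ⊆ span (λ i → ι ∘ bᵂ i)
    cut⊆span {v} ((v∈U , _) , v∈φ) = span-lift bᵂ λ s → KV.BasisOf.spanning W
      ( span-lower U (KV.basisOf U) (KV.BasisOf.contained U) v∈U s
      , KV.∈φ⁺ S {π s ∘ v} λ j∉ → K.trans (π-cong s (∈φ⁻ S {v} v∈φ j∉)) (π-0 s) )

    -- `X` lies in `W` ⊗ `L`. A basis vector of `W` outside `φ A` is not annihilated by `g`, so the
    -- inclusion is then proper.
    cut-dim : (W KV.⊆ KV.φ A) ⊎ dim X < KV.dim W
    cut-dim with Fin.all? (λ i → bᵂ i KV.∈? KV.φ A)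
    ... | yes all = inj₁ (KV.basis⊆⇒⊆ W (KV.φ A) all)
    ... | no ¬all with Fin.¬∀⟶∃¬ _ _ (λ i → bᵂ i KV.∈? KV.φ A) ¬all
    ...   | i , b∉φA = inj₂ (independent≤span (w ∷ᵥ basisOf X) (λ i → ι ∘ bᵂ i)
      (extend {v = w} {basisOf X} (BasisOf.independent X) λ w∈ → w∉X
        (span-least X (basisOf X) (BasisOf.contained X) {w} w∈))
      λ where
        zero    → ∈span (λ i → ι ∘ bᵂ i) i
        (suc j) → cut⊆span (BasisOf.contained X j))
      where
      w = ι ∘ bᵂ i
      w∉X : w ∉ X
      w∉X ((_ , lift w⊥g) , _) = b∉φA (dot-g≈0⇒∈φ (bᵂ i) w⊥g)

    cut-dim≤ : dim X ≤ KV.dim W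
    cut-dim≤ = dim≤ X (λ i → ι ∘ bᵂ i) cut⊆span

-- Over `F` this is `Hall`; the field is a parameter because the recursion on the rows moves up the
-- tower.
HallCondition : (K : FiniteField c ℓ p) → Vector (Subset n) k →
                LinearAlgebra.Subspace K n → Set
HallCondition K 𝒜 U = ∀ S → dim (U ∩ φ S) ≤ ∣ avoidable 𝒜 S ∣
  where open LinearAlgebra K

-- The condition on all `π s ∘ u` says that `u` lies in `U` ⊗ `L`, so `injective` makes `G`
-- injective on the scalar extension of every `U` that satisfies the Hall condition.
record GenericMatrix (K : FiniteField c ℓ p) (𝒜 : Vector (Subset n) k)
  : Set (lsuc (c ⊔ ℓ)) where
  field
    {order}     : ℕ
    L           : FiniteField c ℓ order
    coordinates : Coordinates K L
  open Coordinates coordinates public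
  open FiniteField L using (_≈_; 0#)
  open LinearAlgebra L using (V; Matrix; _≋_; 0ᵥ)
  field
    G           : Matrix k n
    vanishes    : ∀ i {j} → j ∈ˢ 𝒜 i → G i j ≈ 0#
    injective   : ∀ U → HallCondition K 𝒜 U → ∀ {u : V n} →
                  (∀ s → LinearAlgebra.Subspace.Member U (π s ∘ u)) →
                  (∀ i → dot L u (G i) ≈ 0#) → u ≋ 0ᵥ

genericMatrix : (K : FiniteField c ℓ p) (𝒜 : Vector (Subset n) k) → GenericMatrix K 𝒜
genericMatrix {n = n} {zero} K 𝒜 = record
  { L           = K
  ; coordinates = identityCoordinates K
  ; G           = []ᵥ
  ; vanishes    = λ ()
  -- With no sets left, the Hall condition at the full coordinate set says that `U` is zero.
  ; injective   = λ U hall {u} u∈ _ → dim≤0⇒≋0 (U ∩ φ ⊤) (hall ⊤)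
      (u∈ zero , ∈φ⁺ ⊤ {u} λ j∉ → contradiction ∈⊤ j∉)
  }
  where
  open LinearAlgebra K
  open LinearAlgebraProperties K
genericMatrix {n = n} {suc k} K 𝒜 with genericVector n K
... | p′ , K′ , E , t , t-indep = record
  { L           = Rest.L
  ; coordinates = composeCoordinates E Rest.coordinates
  ; G           = (Rest.ι ∘ H.g) ∷ᵥ Rest.G
  ; vanishes    = λ where
      zero    j∈ → L.trans (Rest.⟦⟧-cong (H.g-vanishes j∈)) Rest.0#-homo
      (suc i) j∈ → Rest.vanishes i j∈
  ; injective   = λ U hall {u} u∈ u⊥ →
      Rest.injective (H.cut U) (cut-Hall U hall)
        (λ s → H.∈cut⁺ U (λ t → LinearAlgebra.Subspace.resp U
            (λ j → K.reflexive (π-pair E Rest.coordinates t s (u j))) (u∈ (pair t s)))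
          -- The first row has entries in `K′`, so its equation over `Rest.L` splits into one
          -- equation for each coordinate over `K′`.
          (K′.trans (K′.sym (Rest.π-dot s u H.g))
            (K′.trans (Rest.π-cong s (u⊥ zero)) (Rest.π-0 s))))
        (u⊥ ∘ suc)
  }
  where
  module K  = FiniteField K
  module K′ = FiniteField K′
  module H  = Hyperplane E (𝒜 zero) t t-indep
  module Rest = GenericMatrix (genericMatrix K′ (𝒜 ∘ suc))
  module L  = FiniteField Rest.L
  module KV where
    open LinearAlgebra K public
    open LinearAlgebraProperties K public

  -- Dropping the first set removes at most one index from N(S), which a drop in dimension pays for.
  -- Without a drop, `S` may be replaced by `S ∩ˢ 𝒜 zero`, whose N does not contain the first index.
  cut-Hall : ∀ U → HallCondition K 𝒜 U → HallCondition K′ (𝒜 ∘ suc) (H.cut U)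
  cut-Hall U hall S with H.cut-dim U S
  ... | inj₂ lt = ℕ.s≤s⁻¹ (ℕ.≤-trans lt (ℕ.≤-trans (hall S) (∣avoidable∣-suc 𝒜 S)))
  ... | inj₁ ⊆φA = begin
    _                                      ≤⟨ H.cut-dim≤ U S ⟩
    KV.dim (U KV.∩ KV.φ S)                 ≤⟨ KV.dim-mono (U KV.∩ KV.φ S) (U KV.∩ KV.φ T)
      (λ {v} v∈ → proj₁ v∈ , KV.support⊆⇒∈φ v T λ j∈ → x∈p∩q⁺
        (KV.∈φ⇒support⊆ v S (proj₂ v∈) j∈ , KV.∈φ⇒support⊆ v (𝒜 zero) (⊆φA {v} v∈) j∈)) ⟩
    KV.dim (U KV.∩ KV.φ T)                 ≤⟨ hall T ⟩
    ∣ avoidable 𝒜 T ∣                      ≤⟨ ∣avoidable∣-skip 𝒜 T (p∩q⊆q S (𝒜 zero)) ⟩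
    ∣ avoidable (𝒜 ∘ suc) T ∣              ≤⟨ p⊆q⇒∣p∣≤∣q∣ (avoidable-mono (𝒜 ∘ suc) (p∩q⊆p S (𝒜 zero))) ⟩
    ∣ avoidable (𝒜 ∘ suc) S ∣              ∎
    where
    open ℕ.≤-Reasoning
    T = S ∩ˢ 𝒜 zero

module CoordinateRepresentation {c ℓ q} {F : FiniteField c ℓ q} (Mq : QMatroid F n)
  (coordinate : IsCoordinate Mq) (M : Matroid n) (corresponding : IsCorrespondingMatroid Mq M)
  (𝒜 : Vector (Subset n) k)
  (presents : ∀ X → Matroid.Independent M X ⇔ HasAvoidanceTransversal (≡.setoid (Fin n))
                      (λ i → _∈ˢ 𝒜 i) (_∈ˢ X))
  where
  open QMatroid Mq
  open QMatroidProperties Mq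
  open CoordinateTransversal Mq coordinate M corresponding 𝒜 presents
  open LinearAlgebra F
  open LinearAlgebraProperties F
  open GenericMatrix (genericMatrix F 𝒜)
  private
    module F = FiniteField F
    module L where
      open FiniteField L public hiding (zero)
      open LinearAlgebra L public
      open LinearAlgebraProperties L public
  open import Algebra.Properties.CommutativeMonoid.Sum L.+-commutativeMonoid
    using (sum; sum-cong-≋)

  T : V n → L.V k
  T v = L.combine (ι ∘ v) λ j i → G i j

  T-cong : ∀ {v w} → v ≋ w → T v L.≋ T w
  T-cong v≋w = L.combine-cong (λ j i → G i j) λ j → ⟦⟧-cong (v≋w j)

  T-combine : (s : V l) (b : Vector (V n) l) → T (combine s b) L.≋ L.combine (ι ∘ s) (T ∘ b)
  T-combine s b = L.≋-trans (L.combine-cong (λ j i → G i j) (ι-combine s b))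
    (L.combine-combine (ι ∘ s) (λ i j → ι (b i j)) λ j i → G i j)

  T-span : (Z : L.Subspace k) (b : Vector (V n) l) → (∀ i → T (b i) L.∈ Z) →
           ∀ {v} → v ∈ span b → T v L.∈ Z
  T-span Z b Tb∈ {v} (s , v≋) = L.Subspace.resp Z
    (L.≋-sym (L.≋-trans (T-cong v≋) (T-combine s b)))
    (L.combine∈ Z (T ∘ b) Tb∈ (ι ∘ s))

  T-prolongs : {b : Vector (V n) l} {b′ : Vector (V n) (d ℕ.+ l)} → Prolongs b d b′ →
    (P : Vector (L.V k) p) → (∀ i → T (b i) L.∈ L.span P) →
    ∃ λ (P′ : Vector (L.V k) (d ℕ.+ p)) → ∀ i → T (b′ i) L.∈ L.span P′
  T-prolongs base          P Tb∈ = P , Tb∈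
  T-prolongs (step v prol) P Tb∈ with T-prolongs prol P Tb∈
  ... | P′ , Tb′∈ = T v ∷ᵥ P′ , λ where
    zero    → L.head∈ (T v) P′
    (suc i) → L.shift (T v) P′ (Tb′∈ i)

  -- An index outside N(S) has `S` inside `𝒜 i`, where row `i` vanishes.
  T-supported : ∀ S {v} → v ∈ φ S → L.SupportedOn (avoidable 𝒜 S) (T v)
  T-supported S {v} v∈ {i} i∉ = L.trans (sum-cong-≋ term≈0) (L.combine-0 (λ j i → G i j) i)
    where
    S⊆A : S ⊆ˢ 𝒜 i
    S⊆A = decidable-stable (S ⊆ˢ? 𝒜 i) (λ S⊈A → i∉ (∈-avoidable⁺ 𝒜 S S⊈A))
    term≈0 : ∀ j → ι (v j) L.* G i j L.≈ L.0# L.* G i j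
    term≈0 j with j ∈ˢ? S
    ... | yes j∈ = L.trans (L.trans (L.*-congˡ (vanishes i (S⊆A j∈))) (L.zeroʳ _))
                     (L.sym (L.zeroˡ _))
    ... | no  j∉ = L.*-congʳ (L.trans (⟦⟧-cong (∈φ⁻ S {v} v∈ j∉)) 0#-homo)

  -- A relation `t` among the images gives a vector `u` of `Y` ⊗ `L` killed by `G`, hence zero. Each
  -- coordinate `π s ∘ t` is then a relation over `F` among basis vectors of `Y`.
  T-independent : ∀ Y → Independent Y → L.LinearlyIndependent (T ∘ basisOf Y)
  T-independent Y Y-indep t eq = π-injective λ s →
    BasisOf.independent Y (π s ∘ t) λ j →
      F.trans (F.sym (π-combine s t (basisOf Y) j)) (F.trans (π-cong s (u≋0 j)) (π-0 s))
    where
    ιb : Vector (L.V n) (dim Y)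
    ιb i j = ι (basisOf Y i j)
    u = L.combine t ιb
    u≋0 : u L.≋ L.0ᵥ
    u≋0 = injective Y (independent⇒Hall Y Y-indep)
      (span-lower Y (basisOf Y) (BasisOf.contained Y) (t , L.≋-refl))
      λ i → L.trans (L.combine-combine t ιb (λ j i → G i j) i) (eq i)

  module _ (X : Subspace n) {h} (A : Matrix h n) (X≐A : X ≐ rowSpace A) where

    product : L.Matrix k h
    product = G L.· λ i j → ι (A j i)

    column≋T : ∀ j → (λ i → product i j) L.≋ T (A j)
    column≋T j i = sum-cong-≋ λ t → L.*-comm (G i t) (ι (A j t))

    -- A maximal independent subspace of `X` keeps its dimension under `T`, and its image lies in
    -- the column space of `product`.
    ρ≤rank : ρ X ≤ L.rank product
    ρ≤rank with basisSubspace X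
    ... | Y , Y⊆X , Y-indep , ρX≤ρY = begin
      ρ X             ≤⟨ ρX≤ρY ⟩
      ρ Y             ≡⟨ Y-indep ⟩
      dim Y           ≤⟨ L.independent≤span (T ∘ basisOf Y) P (T-independent Y Y-indep)
                           (λ i → T-span (L.span P) A TA∈ {basisOf Y i}
                             (proj₁ X≐A (Y⊆X (BasisOf.contained Y i)))) ⟩
      L.rank product  ∎
      where
      open ℕ.≤-Reasoning
      P = proj₁ (L.columns∈ product)
      TA∈ : ∀ j → T (A j) L.∈ L.span P
      TA∈ j = L.Subspace.resp (L.span P) (column≋T j) (proj₂ (L.columns∈ product) j)

    -- In a basis of `X` that prolongs one of `X ∩ φ S`, the old vectors map into the coordinate
    -- space of N(S) and each new vector adds at most one dimension.
    rank≤ρ : L.rank product ≤ ρ X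
    rank≤ρ = decidable-stable (L.rank product ℕ.≤? ρ X) λ ≰ →
      ¬¬-avoidable-bound X λ S bound → ≰ (from-bound S bound)
      where
      open ℕ.≤-Reasoning
      from-bound : ∀ S → ∣ avoidable 𝒜 S ∣ ℕ.+ dim X ≤ ρ X ℕ.+ dim (X ∩ φ S) →
                   L.rank product ≤ ρ X
      from-bound S bound
        with prolong X {basisOf (X ∩ φ S)} (BasisOf.independent (X ∩ φ S))
               (λ i → proj₁ (BasisOf.contained (X ∩ φ S) i))
      ... | l , b , prol , B
        with T-prolongs prol (L.e ∘ elements (avoidable 𝒜 S)) (λ i →
               L.supported⇒∈span (avoidable 𝒜 S) {T (basisOf (X ∩ φ S) i)}
                 (T-supported S {basisOf (X ∩ φ S) i} (proj₂ (BasisOf.contained (X ∩ φ S) i))))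
      ... | P , Tb∈ = ℕ.+-cancelʳ-≤ (dim (X ∩ φ S)) _ _ (begin
        L.rank product ℕ.+ dim (X ∩ φ S)
          ≤⟨ ℕ.+-monoˡ-≤ _ (L.rank≤ product P λ j →
               L.Subspace.resp (L.span P) (L.≋-sym (column≋T j))
                 (T-span (L.span P) b Tb∈ {A j} (IsBasis.spanning B (proj₂ X≐A {A j} (∈span A j))))) ⟩
        (l ℕ.+ ∣ avoidable 𝒜 S ∣) ℕ.+ dim (X ∩ φ S)
          ≡⟨ ≡.cong (ℕ._+ dim (X ∩ φ S)) (ℕ.+-comm l _) ⟩
        (∣ avoidable 𝒜 S ∣ ℕ.+ l) ℕ.+ dim (X ∩ φ S)
          ≡⟨ ℕ.+-assoc (∣ avoidable 𝒜 S ∣) l _ ⟩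
        ∣ avoidable 𝒜 S ∣ ℕ.+ (l ℕ.+ dim (X ∩ φ S))
          ≡⟨ ≡.cong (∣ avoidable 𝒜 S ∣ ℕ.+_) (dim-unique X B) ⟨
        ∣ avoidable 𝒜 S ∣ ℕ.+ dim X
          ≤⟨ bound ⟩
        ρ X ℕ.+ dim (X ∩ φ S)
          ∎)

  isRepresentable : IsRepresentable Mq
  isRepresentable = transport size L extension G
    (λ X A X≐A → ℕ.≤-antisym (ρ≤rank X A X≐A) (rank≤ρ X A X≐A))
    where
    -- The order of `L` equals q^`degree` only propositionally, so the field is generalised before
    -- the equation is matched.
    transport : ∀ {p′} → p′ ≡ q ^ degree → (K : FiniteField c ℓ p′) (E : Extension F K)
      (G : LinearAlgebra.Matrix K k n) →
      (∀ X {h} (A : Matrix h n) → X ≐ rowSpace A →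
        ρ X ≡ LinearAlgebra.rank K (LinearAlgebra._·_ K G (λ i j → Extension.ι E (A j i)))) →
      IsRepresentable Mq
    transport ≡.refl K E G ρ≡rank = degree , 1≤degree , K , E , _ , G , ρ≡rank

theorem3p15 : ∀ {c ℓ} (q : ℕ) → IsPrimePower q → (F : FiniteField c ℓ q) →
    (n : ℕ) (Mq : QMatroid F n) → IsCoordinate Mq →
    (M : Matroid n) → IsCorrespondingMatroid Mq M → IsTransversal M →
    IsQTransversal Mq × IsRepresentable Mq
theorem3p15 q _ F n Mq coordinate M corresponding (k , 𝒜 , presents) =
  CoordinateTransversal.isQTransversal Mq coordinate M corresponding 𝒜 presents ,
  CoordinateRepresentation.isRepresentable Mq coordinate M corresponding 𝒜 presents
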